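{- Let $p$ and $q$ be positive integers with $p<q$, and let $\varepsilon>0$. Then for all sufficiently large $N$ there is a collection of $q$ graphs $G_0,\ldots,G_{q-1}$ on a common vertex set $V$ with $|V|=N$ such that every pair of distinct vertices of $V$ is an edge of exactly $p$ of these graphs, and for each $f\in\{0,1,\ldots,q-1\}$: (i) $G_f$ has edge density $e(G_f)/\binom{N}{2}\in[p/q-\varepsilon,\,p/q+\varepsilon]$; (ii) $G_f$ has no vertex subset $U$ with $|U|\ge\varepsilon N$ such that among any $q$ vertices of $U$ there are $p+1$ vertices with at least $\varepsilon N$ common neighbors in $G_f$. -}

module Defs where

open import Data.Bool using (Bool; true; false; _∧_; _∨_; not; if_then_else_)
open import Data.Nat using (ℕ; zero; suc; _<ᵇ_)
open import Data.Nat.Combinatorics using (_C_)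
import Data.Nat as ℕ
open import Data.Fin using (Fin; toℕ)
open import Data.Fin.Subset using (Subset; inside; outside)
open import Data.Vec using (Vec; tabulate; countᵇ; foldr′; lookup)
open import Data.Vec using (allFin) public
import Data.Vec
open import Data.Integer using (+_)
open import Data.Rational using (ℚ; _/_; 0ℚ)
open import Relation.Binary.PropositionalEquality using (_≡_)

#ᵇ : ∀ {n} → (Fin n → Bool) → ℕ
#ᵇ {n} P = countᵇ P (allFin n)

∀ᵇ : ∀ {n} → (Fin n → Bool) → Bool
∀ᵇ {n} P = foldr′ _∧_ true (tabulate P)

_∈ᵇ_ : ∀ {n} → Fin n → Subset n → Bool
i ∈ᵇ U = lookup U i

ℕ→ℚ : ℕ → ℚ
ℕ→ℚ n = + n / 1

-- the rational p/q (q > 0 in all uses; value 0 for q = 0 is a dummy)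
ratio : ℕ → ℕ → ℚ
ratio p zero    = 0ℚ
ratio p (suc q) = + p / suc q

record IsGraph {N : ℕ} (adj : Fin N → Fin N → Bool) : Set where
  field
    symmetric   : ∀ u v → adj u v ≡ adj v u
    irreflexive : ∀ v → adj v v ≡ false

edges : ∀ {N} → (Fin N → Fin N → Bool) → ℕ
edges adj = Data.Vec.sum (tabulate λ u → #ᵇ λ v → (toℕ u <ᵇ toℕ v) ∧ adj u v)

commonNbrs : ∀ {N} → (Fin N → Fin N → Bool) → Subset N → ℕ
commonNbrs adj T = #ᵇ λ w → ∀ᵇ λ t → not (t ∈ᵇ T) ∨ adj t w

-- edge density e(G)/binom(N,2) of a graph on Fin N (dummy value 0 when N < 2)
density : ∀ {N} → (Fin N → Fin N → Bool) → ℚ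
density {N} adj = ratio (edges adj) (N C 2)

{-# OPTIONS --safe #-}
-- A vertex carries a point x ∈ (ℤ/q)ⁿ and an index j < n; the pair (x , j), (y , i) has colour
-- x_i + y_j ∈ ℤ/q, and G_f consists of the pairs whose colour plus f lies in {0, …, p − 1}.
-- Each colour is equidistributed, which gives the densities. A linear-sized U contains, for some j,
-- a positive proportion of the points x, so by concentration of measure on (ℤ/q)ⁿ it contains
-- vertices u₀, …, u_{q−1} of index j close to x, x + 1, …, x + (q − 1) for a single x. At all but
-- few indices i the colours from the uₐ to a vertex (y , i) are then the q distinct residues, of which
-- only p lie in the window: hence any p + 1 of the uₐ have few common neighbours.
module Submission where

open import Defs

-- A variance bound is concentration enough, since the union bound runs over only `q` translates. It
-- constrains the radius `r` of "close" from both sides. A 1-Lipschitz function on the cube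
-- fluctuates on the scale of the square root of `n`, so `r` must exceed that by a factor depending
-- on `q` and ε. But the `q` chosen vertices may together deviate from the translates at up to `q r`
-- coordinates, and each such coordinate admits about an `n`-th part of all vertices as common
-- neighbours, so `r` must also be a small fraction of `n`. Both hold once `n` is large in terms of
-- `q` and ε; `n` then stays fixed while `N` grows. The chosen vertices must share their index `j`:
-- towards `(y , i)` the colour contains `y_j`, and only for a common `j` is this one and the same
-- shift of all `q` colours. Everything before the last step lives in ℕ, with `1/k` for ε and with
-- divisions and subtractions moved across the inequality; this explains the form of most estimates.

-- Finite sums over `Fin n` and sums over ℤ/q.

module Sums where
  open import Data.Bool using (Bool; true; false)
  open import Data.Fin using (Fin; zero; suc; toℕ; inject≤; combine; remQuot; _↑ˡ_; _↑ʳ_; _≟_)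
  open import Data.Fin.Properties using (remQuot-combine; toℕ<n)
  open import Data.Nat using (ℕ; zero; suc; _+_; _*_; _≤_; _<_; z≤n; s≤s; NonZero; _<ᵇ_)
  open import Data.Nat.DivMod using (_%_; _mod_; m<n⇒m%n≡m; [m+n]%n≡m%n)
  open import Data.Nat.Properties hiding (_≟_)
  open import Data.Nat.Tactic.RingSolver using (solve-∀)
  open import Algebra.Properties.Semiring.Sum +-*-semiring public
    using (sum; sum-syntax; ∑-distrib-+; ∑-comm; sum-cong-≗; *-distribˡ-sum; *-distribʳ-sum)
  open import Data.Product using (∃; _×_; _,_)
  open import Data.Sum using (inj₁; inj₂)
  open import Function using (_∘_)
  open import Relation.Nullary using (does; yes; no; contradiction)
  open import Relation.Binary.PropositionalEquality

  private variable
    m n : ℕ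

  ind : Bool → ℕ
  ind true  = 1
  ind false = 0

  ind≤1 : ∀ b → ind b ≤ 1
  ind≤1 true  = ≤-refl
  ind≤1 false = z≤n

  ind-mono : ∀ {b c} → (b ≡ true → c ≡ true) → ind b ≤ ind c
  ind-mono {false} h = z≤n
  ind-mono {true}  h = ≤-reflexive (cong ind (sym (h refl)))

  sum-mono : {f g : Fin n → ℕ} → (∀ i → f i ≤ g i) → sum f ≤ sum g
  sum-mono {zero}  h = z≤n
  sum-mono {suc n} h = +-mono-≤ (h zero) (sum-mono (h ∘ suc))

  sum-const : ∀ n c → sum {n} (λ _ → c) ≡ n * c
  sum-const zero    c = refl
  sum-const (suc n) c = cong (c +_) (sum-const n c)

  term≤sum : (f : Fin n → ℕ) → ∀ i → f i ≤ sum f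
  term≤sum f zero    = m≤m+n _ _
  term≤sum f (suc i) = ≤-trans (term≤sum (f ∘ suc) i) (m≤n+m _ _)

  -- All terms but one are replaced by their bound. The `b` on the left stands for the `n − 1` on
  -- the right, avoiding truncated subtraction.
  sum-≤-one-exact : ∀ (f : Fin n → ℕ) {b} → (∀ i → f i ≤ b) → ∀ i → sum f + b ≤ f i + n * b
  sum-≤-one-exact {suc n} f {b} h zero = begin
    f zero + sum (f ∘ suc) + b    ≡⟨ +-assoc (f zero) _ b ⟩
    f zero + (sum (f ∘ suc) + b)  ≡⟨ cong (f zero +_) (+-comm _ b) ⟩
    f zero + (b + sum (f ∘ suc))  ≤⟨ +-monoʳ-≤ (f zero) (+-monoʳ-≤ b (sum-mono (h ∘ suc))) ⟩
    f zero + (b + sum {n} (λ _ → b)) ≡⟨ cong (λ s → f zero + (b + s)) (sum-const n b) ⟩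
    f zero + (b + n * b) ∎
    where open ≤-Reasoning
  sum-≤-one-exact {suc n} f {b} h (suc i) = begin
    f zero + sum (f ∘ suc) + b    ≡⟨ +-assoc (f zero) _ b ⟩
    f zero + (sum (f ∘ suc) + b)  ≤⟨ +-mono-≤ (h zero) (sum-≤-one-exact (f ∘ suc) (h ∘ suc) i) ⟩
    b + (f (suc i) + n * b)       ≡⟨ arith b (f (suc i)) (n * b) ⟩
    f (suc i) + (b + n * b) ∎
    where
    open ≤-Reasoning
    arith : ∀ x y z → x + (y + z) ≡ y + (x + z)
    arith = solve-∀

  sum*sum : (f : Fin m → ℕ) (g : Fin n → ℕ) → sum f * sum g ≡ ∑[ i < m ] ∑[ j < n ] (f i * g j)
  sum*sum f g = trans (*-distribʳ-sum (sum g) f) (sum-cong-≗ λ i → *-distribˡ-sum (f i) g)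

  ∃-above-average : .{{_ : NonZero n}} (f : Fin n → ℕ) → ∃ λ i → sum f ≤ n * f i
  ∃-above-average {suc zero}    f = zero , ≤-refl
  ∃-above-average {suc (suc n)} f with ∃-above-average (f ∘ suc)
  ... | i , h with ≤-total (f zero) (f (suc i))
  ...   | inj₁ le = suc i , +-mono-≤ le h
  ...   | inj₂ ge = zero , +-monoʳ-≤ (f zero) (≤-trans h (*-monoʳ-≤ (suc n) ge))

  -- The first-moment argument: it yields a point none of whose translates fails, and later a
  -- coordinate without defect.
  sum<n⇒∃≡0 : (f : Fin n → ℕ) → sum f < n → ∃ λ i → f i ≡ 0
  sum<n⇒∃≡0 {suc n} f lt with f zero in eq
  ... | zero  = zero , eq
  ... | suc k with sum<n⇒∃≡0 (f ∘ suc) (≤-trans (s≤s (m≤n+m _ k)) (s≤s⁻¹ lt))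
    where open import Data.Nat using (s≤s⁻¹)
  ...   | i , h = suc i , h

  sum≡0⇒≡0 : (f : Fin n → ℕ) → sum f ≡ 0 → ∀ i → f i ≡ 0
  sum≡0⇒≡0 f h i = n≤0⇒n≡0 (≤-trans (term≤sum f i) (≤-reflexive h))

  sum-+ : ∀ m (f : Fin (m + n) → ℕ) → sum f ≡ ∑[ i < m ] f (i ↑ˡ n) + ∑[ j < n ] f (m ↑ʳ j)
  sum-+ zero    f = refl
  sum-+ (suc m) f = trans (cong (f zero +_) (sum-+ m (f ∘ suc))) (sym (+-assoc (f zero) _ _))

  sum-combine : ∀ m n (f : Fin (m * n) → ℕ) → sum f ≡ ∑[ i < m ] ∑[ j < n ] f (combine i j)
  sum-combine zero    n f = refl
  sum-combine (suc m) n f =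
    trans (sum-+ n f) (cong (sum (λ j → f (j ↑ˡ (m * n))) +_) (sum-combine m n (f ∘ (n ↑ʳ_))))

  sum-remQuot : ∀ m n (f : Fin m × Fin n → ℕ) →
    sum (f ∘ remQuot {m} n) ≡ ∑[ i < m ] ∑[ j < n ] f (i , j)
  sum-remQuot m n f = trans (sum-combine m n _)
    (sum-cong-≗ λ i → sum-cong-≗ λ j → cong f (remQuot-combine i j))

  sum-inject≤ : (f : Fin n → ℕ) (m≤n : m ≤ n) → ∑[ i < m ] f (inject≤ i m≤n) ≤ sum f
  sum-inject≤ {m = zero}          f _         = z≤n
  sum-inject≤ {suc n} {m = suc m} f (s≤s m≤n) = +-monoʳ-≤ (f zero) (sum-inject≤ (f ∘ suc) m≤n)

  ≟-refl : (i : Fin n) → does (i ≟ i) ≡ true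
  ≟-refl i with i ≟ i
  ... | yes _ = refl
  ... | no ¬p = contradiction refl ¬p

  sum-δ : (i : Fin n) (f : Fin n → ℕ) → ∑[ j < n ] (ind (does (j ≟ i)) * f j) ≡ f i
  sum-δ {suc n} zero f = begin
    f zero + 0 + ∑[ j < n ] 0 ≡⟨ cong₂ _+_ (+-identityʳ (f zero)) (trans (sum-const n 0) (*-zeroʳ n)) ⟩
    f zero + 0                ≡⟨ +-identityʳ (f zero) ⟩
    f zero                    ∎
    where open ≡-Reasoning
  sum-δ {suc n} (suc i) f = sum-δ i (f ∘ suc)

  rotate : ∀ {q} .{{_ : NonZero q}} → ℕ → Fin q → Fin q
  rotate {q} c a = (c + toℕ a) mod q

  private
    sum-telescope : ∀ n (g : ℕ → ℕ) → ∑[ i < n ] g (toℕ i) + g n ≡ g 0 + ∑[ i < n ] g (suc (toℕ i))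
    sum-telescope zero    g = sym (+-identityʳ (g 0))
    sum-telescope (suc n) g = begin
      g 0 + ∑[ i < n ] g (suc (toℕ i)) + g (suc n)     ≡⟨ +-assoc (g 0) _ _ ⟩
      g 0 + (∑[ i < n ] g (suc (toℕ i)) + g (suc n))   ≡⟨ cong (g 0 +_) (sum-telescope n (g ∘ suc)) ⟩
      g 0 + (g 1 + ∑[ i < n ] g (suc (suc (toℕ i))))   ∎
      where open ≡-Reasoning

  -- Sliding the window by one drops `g c` and gains `g (c + q)`, which are equal by periodicity;
  -- adding `g c` to both sides makes this a cancellation in ℕ.
  sum-periodic : ∀ q (g : ℕ → ℕ) → (∀ x → g (x + q) ≡ g x) → ∀ c →
    ∑[ i < q ] g (c + toℕ i) ≡ ∑[ i < q ] g (toℕ i)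
  sum-periodic q g per zero    = refl
  sum-periodic q g per (suc c) = trans (+-cancelˡ-≡ (g c) _ _ (begin
    g c + ∑[ i < q ] g (suc c + toℕ i)                   ≡⟨ cong₂ (λ x s → g x + s) (+-identityʳ c) (sum-cong-≗ {q} λ i → cong g (+-suc c (toℕ i))) ⟨
    g (c + 0) + ∑[ i < q ] g (c + suc (toℕ i))           ≡⟨ sum-telescope q (g ∘ (c +_)) ⟨
    ∑[ i < q ] g (c + toℕ i) + g (c + q)                 ≡⟨ cong (∑[ i < q ] g (c + toℕ i) +_) (per c) ⟩
    ∑[ i < q ] g (c + toℕ i) + g c                       ≡⟨ +-comm _ (g c) ⟩
    g c + ∑[ i < q ] g (c + toℕ i)                       ∎)) (sum-periodic q g per c)
    where open ≡-Reasoning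

  sum-rotate : ∀ {q} .{{_ : NonZero q}} (h : Fin q → ℕ) c → ∑[ a < q ] h (rotate c a) ≡ sum h
  sum-rotate {q} h c = trans (sum-periodic q (λ x → h (x mod q)) (λ x → cong h (mod-cong ([m+n]%n≡m%n x q))) c)
    (sum-cong-≗ λ a → cong h (toℕ-mod a))
    where
    open import Data.Fin.Properties using (toℕ-injective; toℕ-fromℕ<)
    mod-cong : ∀ {x y} → x % q ≡ y % q → x mod q ≡ y mod q
    mod-cong e = toℕ-injective (trans (toℕ-fromℕ< _) (trans e (sym (toℕ-fromℕ< _))))
    toℕ-mod : ∀ (a : Fin q) → toℕ a mod q ≡ a
    toℕ-mod a = toℕ-injective (trans (toℕ-fromℕ< _) (m<n⇒m%n≡m (toℕ<n a)))

  count-< : ∀ {p q} → p ≤ q → ∑[ a < q ] ind (toℕ a <ᵇ p) ≡ p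
  count-< {q = q} z≤n       = trans (sum-const q 0) (*-zeroʳ q)
  count-< (s≤s p≤q) = cong suc (count-< p≤q)

  -- The window {0, …, p − 1} of ℤ/q is met p times by any translate of ℤ/q.
  count-window : ∀ {p q} .{{_ : NonZero q}} → p ≤ q → ∀ c →
    ∑[ a < q ] ind ((c + toℕ a) % q <ᵇ p) ≡ p
  count-window {p} {q} p≤q c = begin
    ∑[ a < q ] ind ((c + toℕ a) % q <ᵇ p) ≡⟨ sum-periodic q (λ x → ind (x % q <ᵇ p)) (λ x → cong (λ y → ind (y <ᵇ p)) ([m+n]%n≡m%n x q)) c ⟩
    ∑[ a < q ] ind (toℕ a % q <ᵇ p)       ≡⟨ sum-cong-≗ {q} (λ a → cong (λ y → ind (y <ᵇ p)) (m<n⇒m%n≡m (toℕ<n a))) ⟩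
    ∑[ a < q ] ind (toℕ a <ᵇ p)           ≡⟨ count-< p≤q ⟩
    p                                     ∎
    where open ≡-Reasoning

-- The cube (ℤ/q)ⁿ: uniform sums and Hamming distance.

module Cube where
  open Sums
  open import Data.Bool using (Bool; true; false; not; if_then_else_; T)
  open import Data.Fin using (Fin; zero; suc; toℕ; remQuot; _≟_)
  open import Data.Nat using (ℕ; zero; suc; _+_; _*_; _^_; _⊓_; _≤_; _<_; z≤n; NonZero; _≤ᵇ_; _<?_)
  open import Data.Nat.Properties hiding (_≟_; _<?_)
  open import Data.Nat.Tactic.RingSolver using (solve-∀)
  open import Data.Product using (∃; _×_; _,_; uncurry)
  open import Data.Sum using (inj₁; inj₂)
  open import Data.Vec using (Vec; []; _∷_; lookup; map)
  open import Function using (_∘_)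
  open import Relation.Nullary using (does; yes; no; contradiction)
  open import Relation.Binary.PropositionalEquality

  private variable
    n q N : ℕ

  -- The base-`q` digits of the argument, most significant first. Sums over the cube become sums
  -- over `Fin`, and induction on `n` conditions on the first coordinate.
  point : ∀ n → Fin (q ^ n) → Vec (Fin q) n
  point {q} zero    _ = []
  point {q} (suc n) k = uncurry (λ a k′ → a ∷ point n k′) (remQuot {q} (q ^ n) k)

  sum-point : ∀ n (f : Vec (Fin q) (suc n) → ℕ) →
    ∑[ k < q ^ suc n ] f (point (suc n) k) ≡ ∑[ a < q ] ∑[ k < q ^ n ] f (a ∷ point n k)
  sum-point {q} n f = sum-remQuot q (q ^ n) (λ ak → f (uncurry (λ a k → a ∷ point n k) ak))

  -- Each coordinate of a uniform point is uniform; the factor `q` replaces a division of `q ^ n` by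
  -- `q`.
  sum-marginal : ∀ (g : Fin q → ℕ) (i : Fin n) →
    q * ∑[ k < q ^ n ] g (lookup (point n k) i) ≡ q ^ n * sum g
  sum-marginal {q} {suc n} g zero = begin
    q * ∑[ k < q ^ suc n ] g (lookup (point (suc n) k) zero) ≡⟨ cong (q *_) (sum-point n (λ x → g (lookup x zero))) ⟩
    q * ∑[ a < q ] ∑[ k < q ^ n ] g a    ≡⟨ cong (q *_) (sum-cong-≗ {q} λ a → sum-const (q ^ n) (g a)) ⟩
    q * ∑[ a < q ] (q ^ n * g a)         ≡⟨ cong (q *_) (*-distribˡ-sum (q ^ n) g) ⟨
    q * (q ^ n * sum g)                  ≡⟨ *-assoc q (q ^ n) _ ⟨
    q ^ suc n * sum g                    ∎
    where open ≡-Reasoning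
  sum-marginal {q} {suc n} g (suc i) = begin
    q * ∑[ k < q ^ suc n ] g (lookup (point (suc n) k) (suc i)) ≡⟨ cong (q *_) (sum-point n (λ x → g (lookup x (suc i)))) ⟩
    q * ∑[ a < q ] ∑[ k < q ^ n ] g (lookup (point n k) i)      ≡⟨ cong (q *_) (sum-const q (∑[ k < q ^ n ] g (lookup (point n k) i))) ⟩
    q * (q * ∑[ k < q ^ n ] g (lookup (point n k) i))           ≡⟨ cong (q *_) (sum-marginal g i) ⟩
    q * (q ^ n * sum g)                                         ≡⟨ *-assoc q (q ^ n) _ ⟨
    q ^ suc n * sum g                                           ∎
    where open ≡-Reasoning

  sum-translate : .{{_ : NonZero q}} → ∀ n (f : Vec (Fin q) n → ℕ) c →
    ∑[ k < q ^ n ] f (map (rotate c) (point n k)) ≡ ∑[ k < q ^ n ] f (point n k)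
  sum-translate zero f c = refl
  sum-translate {q} (suc n) f c = begin
    ∑[ k < q ^ suc n ] f (map (rotate c) (point (suc n) k))             ≡⟨ sum-point n (f ∘ map (rotate c)) ⟩
    ∑[ a < q ] ∑[ k < q ^ n ] f (rotate c a ∷ map (rotate c) (point n k)) ≡⟨ sum-cong-≗ {q} (λ a → sum-translate n (λ x → f (rotate c a ∷ x)) c) ⟩
    ∑[ a < q ] ∑[ k < q ^ n ] f (rotate c a ∷ point n k)                ≡⟨ sum-rotate (λ a → ∑[ k < q ^ n ] f (a ∷ point n k)) c ⟩
    ∑[ a < q ] ∑[ k < q ^ n ] f (a ∷ point n k)                         ≡⟨ sum-point n f ⟨
    ∑[ k < q ^ suc n ] f (point (suc n) k)                              ∎
    where open ≡-Reasoning

  differ : Fin q → Fin q → ℕ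
  differ a b = ind (not (does (a ≟ b)))

  differ-refl : (a : Fin q) → differ a a ≡ 0
  differ-refl a rewrite ≟-refl a = refl

  differ≡0⇒≡ : (a b : Fin q) → differ a b ≡ 0 → a ≡ b
  differ≡0⇒≡ a b h with a ≟ b
  ... | yes e = e

  differ-triangle : (a b c : Fin q) → differ a c ≤ differ b c + differ a b
  differ-triangle a b c with a ≟ b
  ... | yes refl = m≤m+n _ 0
  ... | no _     = ≤-trans (ind≤1 _) (m≤n+m 1 _)

  hamming : Vec (Fin q) n → Vec (Fin q) n → ℕ
  hamming {n = n} x y = ∑[ i < n ] differ (lookup x i) (lookup y i)

  hamming-refl : (x : Vec (Fin q) n) → hamming x x ≡ 0
  hamming-refl {n = n} x = trans (sum-cong-≗ (differ-refl ∘ lookup x)) (trans (sum-const n 0) (*-zeroʳ n))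

  hamming-triangle : (x y z : Vec (Fin q) n) → hamming x z ≤ hamming y z + hamming x y
  hamming-triangle x y z = ≤-trans
    (sum-mono λ i → differ-triangle (lookup x i) (lookup y i) (lookup z i))
    (≤-reflexive (∑-distrib-+ (λ i → differ (lookup y i) (lookup z i)) (λ i → differ (lookup x i) (lookup y i))))

  Lipschitz : (Vec (Fin q) n → ℕ) → Set
  Lipschitz f = ∀ x y → f x ≤ f y + hamming x y

  -- Second moments and concentration on the cube.

  sum-pairs : (f : Fin N → ℕ) → ∑[ i < N ] ∑[ j < N ] (f i + f j) ≡ 2 * (N * sum f)
  sum-pairs {N} f = begin
    ∑[ i < N ] ∑[ j < N ] (f i + f j)   ≡⟨ sum-cong-≗ {N} (λ i → trans (∑-distrib-+ {N} (λ _ → f i) f) (cong (_+ sum f) (sum-const N (f i)))) ⟩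
    ∑[ i < N ] (N * f i + sum f)        ≡⟨ ∑-distrib-+ {N} (λ i → N * f i) (λ _ → sum f) ⟩
    ∑[ i < N ] (N * f i) + ∑[ i < N ] sum f ≡⟨ cong₂ _+_ (sym (*-distribˡ-sum N f)) (sum-const N (sum f)) ⟩
    N * sum f + N * sum f               ≡⟨ cong (N * sum f +_) (+-identityʳ (N * sum f)) ⟨
    2 * (N * sum f)                     ∎
    where open ≡-Reasoning

  private
    sq-close-≤ : ∀ {x y d} → x ≤ y → y ≤ x + d → x * x + y * y ≤ 2 * (x * y) + d * d
    sq-close-≤ {x} {y} {d} x≤y y≤x+d with m≤n⇒∃[o]m+o≡n x≤y
    ... | e , refl = ≤-trans (≤-reflexive (arith x e)) (+-monoʳ-≤ (2 * (x * (x + e))) (*-mono-≤ e≤d e≤d))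
      where
      e≤d : e ≤ d
      e≤d = +-cancelˡ-≤ x e d y≤x+d
      arith : ∀ x e → x * x + (x + e) * (x + e) ≡ 2 * (x * (x + e)) + e * e
      arith = solve-∀

  -- This is `(x − y)² ≤ d²`, expanded so that no negative number occurs.
  sq-close : ∀ {x y d} → x ≤ y + d → y ≤ x + d → x * x + y * y ≤ 2 * (x * y) + d * d
  sq-close {x} {y} {d} x≤ y≤ with ≤-total x y
  ... | inj₁ x≤y = sq-close-≤ x≤y y≤
  ... | inj₂ y≤x = subst₂ (λ s t → s ≤ 2 * t + d * d) (+-comm (y * y) (x * x)) (*-comm y x) (sq-close-≤ y≤x x≤)

  amgm : ∀ x y → 2 * (x * y) ≤ x * x + y * y
  amgm x y with ≤-total x y
  ... | inj₁ x≤y with m≤n⇒∃[o]m+o≡n x≤y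
  ...   | e , refl = ≤-trans (m≤m+n _ (e * e)) (≤-reflexive (arith x e))
    where
    arith : ∀ x e → 2 * (x * (x + e)) + e * e ≡ x * x + (x + e) * (x + e)
    arith = solve-∀
  amgm x y | inj₂ y≤x with m≤n⇒∃[o]m+o≡n y≤x
  ...   | e , refl = ≤-trans (m≤m+n _ (e * e)) (≤-reflexive (arith y e))
    where
    arith : ∀ y e → 2 * ((y + e) * y) + e * e ≡ (y + e) * (y + e) + y * y
    arith = solve-∀

  -- The difference `q ∑ s² − (∑ s)²` is half the sum of `(s a − s b)²` over all ordered pairs, each
  -- at most `d²`. The gain of one half is given away.
  sum-sq-spread : ∀ (s : Fin q → ℕ) d → (∀ a b → s a ≤ s b + d) →
    q * ∑[ a < q ] (s a * s a) ≤ sum s * sum s + q * (q * (d * d))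
  sum-sq-spread {q} s d close = *-cancelˡ-≤ 2 (begin
    2 * (q * ∑[ a < q ] (s a * s a))                       ≡⟨ sum-pairs (λ a → s a * s a) ⟨
    ∑[ a < q ] ∑[ b < q ] (s a * s a + s b * s b)          ≤⟨ sum-mono {q} (λ a → sum-mono {q} λ b → sq-close (close a b) (close b a)) ⟩
    ∑[ a < q ] ∑[ b < q ] (2 * (s a * s b) + d * d)        ≡⟨ sum-cong-≗ {q} (λ a → trans (∑-distrib-+ {q} (λ b → 2 * (s a * s b)) (λ _ → d * d)) (cong₂ _+_ (sym (*-distribˡ-sum {q} 2 (λ b → s a * s b))) (sum-const q (d * d)))) ⟩
    ∑[ a < q ] (2 * ∑[ b < q ] (s a * s b) + q * (d * d))  ≡⟨ trans (∑-distrib-+ {q} (λ a → 2 * ∑[ b < q ] (s a * s b)) (λ _ → q * (d * d))) (cong₂ _+_ (sym (*-distribˡ-sum {q} 2 (λ a → ∑[ b < q ] (s a * s b)))) (sum-const q (q * (d * d)))) ⟩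
    2 * ∑[ a < q ] ∑[ b < q ] (s a * s b) + q * (q * (d * d)) ≡⟨ cong (λ t → 2 * t + q * (q * (d * d))) (sum*sum s s) ⟨
    2 * (sum s * sum s) + q * (q * (d * d))                ≤⟨ +-monoʳ-≤ (2 * (sum s * sum s)) (m≤n*m (q * (q * (d * d))) 2) ⟩
    2 * (sum s * sum s) + 2 * (q * (q * (d * d)))          ≡⟨ *-distribˡ-+ 2 (sum s * sum s) _ ⟨
    2 * (sum s * sum s + q * (q * (d * d)))                ∎)
    where open ≤-Reasoning

  -- Efron–Stein: a Lipschitz function on the cube has variance at most n. Conditioning on the
  -- first coordinate, the q conditional sums differ pairwise by at most qⁿ.
  lipschitz-variance : ∀ n (f : Vec (Fin q) n → ℕ) → Lipschitz f →
    q ^ n * ∑[ k < q ^ n ] (f (point n k) * f (point n k))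
      ≤ ∑[ k < q ^ n ] f (point n k) * ∑[ k < q ^ n ] f (point n k) + n * (q ^ n * q ^ n)
  lipschitz-variance zero f lip = ≤-reflexive (arith (f []))
    where
    arith : ∀ x → x * x + 0 + 0 ≡ (x + 0) * (x + 0) + 0
    arith = solve-∀
  lipschitz-variance {q} (suc n) f lip = begin
    q * m * ∑[ k < q ^ suc n ] (f (point (suc n) k) * f (point (suc n) k))
      ≡⟨ cong (q * m *_) (sum-point n (λ x → f x * f x)) ⟩
    q * m * sum S₂                       ≡⟨ *-assoc q m _ ⟩
    q * (m * sum S₂)                     ≡⟨ cong (q *_) (*-distribˡ-sum m S₂) ⟩
    q * ∑[ a < q ] (m * S₂ a)            ≤⟨ *-monoʳ-≤ q (sum-mono {q} λ a → lipschitz-variance n (λ x → f (a ∷ x)) (lip-tail a)) ⟩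
    q * ∑[ a < q ] (S₁ a * S₁ a + n * (m * m))
      ≡⟨ cong (q *_) (trans (∑-distrib-+ {q} (λ a → S₁ a * S₁ a) (λ _ → n * (m * m))) (cong (∑[ a < q ] (S₁ a * S₁ a) +_) (sum-const q (n * (m * m))))) ⟩
    q * (∑[ a < q ] (S₁ a * S₁ a) + q * (n * (m * m)))
      ≡⟨ *-distribˡ-+ q (∑[ a < q ] (S₁ a * S₁ a)) (q * (n * (m * m))) ⟩
    q * ∑[ a < q ] (S₁ a * S₁ a) + q * (q * (n * (m * m)))
      ≤⟨ +-monoˡ-≤ (q * (q * (n * (m * m)))) (sum-sq-spread S₁ m S₁-close) ⟩
    sum S₁ * sum S₁ + q * (q * (m * m)) + q * (q * (n * (m * m)))
      ≡⟨ arith (sum S₁ * sum S₁) q m n ⟩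
    sum S₁ * sum S₁ + suc n * (q * m * (q * m))
      ≡⟨ cong (λ s → s * s + suc n * (q * m * (q * m))) (sum-point n f) ⟨
    ∑[ k < q ^ suc n ] f (point (suc n) k) * ∑[ k < q ^ suc n ] f (point (suc n) k)
      + suc n * (q * m * (q * m)) ∎
    where
    open ≤-Reasoning
    m = q ^ n
    S₁ S₂ : Fin q → ℕ
    S₁ a = ∑[ k < m ] f (a ∷ point n k)
    S₂ a = ∑[ k < m ] (f (a ∷ point n k) * f (a ∷ point n k))
    lip-tail : ∀ a → Lipschitz (λ x → f (a ∷ x))
    lip-tail a x y = subst (λ d → f (a ∷ x) ≤ f (a ∷ y) + (d + hamming x y)) (differ-refl a) (lip (a ∷ x) (a ∷ y))
    S₁-close : ∀ a b → S₁ a ≤ S₁ b + m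
    S₁-close a b = ≤-trans (sum-mono {m} λ k → f-close (point n k)) (≤-reflexive
      (trans (∑-distrib-+ {m} (λ k → f (b ∷ point n k)) (λ _ → 1)) (cong (S₁ b +_) (trans (sum-const m 1) (*-identityʳ m)))))
      where
      f-close : ∀ x → f (a ∷ x) ≤ f (b ∷ x) + 1
      f-close x = ≤-trans (lip (a ∷ x) (b ∷ x)) (+-monoʳ-≤ (f (b ∷ x))
        (≤-trans (≤-reflexive (trans (cong (differ a b +_) (hamming-refl x)) (+-identityʳ _))) (ind≤1 _)))
    arith : ∀ s q m n → s + q * (q * (m * m)) + q * (q * (n * (m * m))) ≡ s + suc n * (q * m * (q * m))
    arith = solve-∀

  nonzero : ℕ → ℕ
  nonzero zero    = 0
  nonzero (suc _) = 1

  iszero : ℕ → ℕ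
  iszero zero    = 1
  iszero (suc _) = 0

  -- Cauchy-Schwarz for `f` against the indicator of its support. It comes from summing over all
  -- pairs an inequality that is AM-GM where both values are nonzero and trivial elsewhere.
  sum-sq≤support : (f : Fin N → ℕ) →
    sum f * sum f ≤ ∑[ i < N ] nonzero (f i) * ∑[ i < N ] (f i * f i)
  sum-sq≤support {N} f = *-cancelˡ-≤ 2 (begin
    2 * (sum f * sum f)                            ≡⟨ cong (2 *_) (sum*sum f f) ⟩
    2 * ∑[ i < N ] ∑[ j < N ] (f i * f j)          ≡⟨ trans (*-distribˡ-sum {N} 2 _) (sum-cong-≗ {N} λ i → *-distribˡ-sum {N} 2 _) ⟩
    ∑[ i < N ] ∑[ j < N ] (2 * (f i * f j))        ≤⟨ sum-mono {N} (λ i → sum-mono {N} λ j → pointwise (f i) (f j)) ⟩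
    ∑[ i < N ] ∑[ j < N ] (nonzero (f j) * (f i * f i) + nonzero (f i) * (f j * f j))
      ≡⟨ trans (sum-cong-≗ {N} λ i → ∑-distrib-+ {N} (λ j → nonzero (f j) * (f i * f i)) (λ j → nonzero (f i) * (f j * f j)))
               (∑-distrib-+ {N} (λ i → ∑[ j < N ] (nonzero (f j) * (f i * f i))) (λ i → ∑[ j < N ] (nonzero (f i) * (f j * f j)))) ⟩
    ∑[ i < N ] ∑[ j < N ] (nonzero (f j) * (f i * f i)) + ∑[ i < N ] ∑[ j < N ] (nonzero (f i) * (f j * f j))
      ≡⟨ cong₂ _+_ (trans (∑-comm {N} {N} (λ i j → nonzero (f j) * (f i * f i))) (sym split)) (sym split) ⟩
    K * S₂ + K * S₂                                ≡⟨ cong (K * S₂ +_) (+-identityʳ (K * S₂)) ⟨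
    2 * (K * S₂)                                   ∎)
    where
    open ≤-Reasoning
    K  = ∑[ i < N ] nonzero (f i)
    S₂ = ∑[ i < N ] (f i * f i)
    split : K * S₂ ≡ ∑[ i < N ] ∑[ j < N ] (nonzero (f i) * (f j * f j))
    split = sum*sum (nonzero ∘ f) (λ i → f i * f i)
    pointwise : ∀ x y → 2 * (x * y) ≤ nonzero y * (x * x) + nonzero x * (y * y)
    pointwise zero    y       = z≤n
    pointwise (suc x) zero    = ≤-trans (≤-reflexive (cong (2 *_) (*-zeroʳ (suc x)))) z≤n
    pointwise (suc x) (suc y) = ≤-trans (amgm (suc x) (suc y))
      (≤-reflexive (cong₂ _+_ (sym (+-identityʳ (suc x * suc x))) (sym (+-identityʳ (suc y * suc y)))))

  -- Since f vanishes on a set of size α, Cauchy–Schwarz bounds (∑ f)² by (qⁿ − α) ∑ f²,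
  -- and the variance bound turns this into α ∑ f² ≤ n q²ⁿ.
  lipschitz-tail : ∀ n (f : Vec (Fin q) n → ℕ) → Lipschitz f → ∀ r →
    ∑[ k < q ^ n ] iszero (f (point n k)) * (∑[ k < q ^ n ] ind (r ≤ᵇ f (point n k)) * (r * r))
      ≤ n * (q ^ n * q ^ n)
  lipschitz-tail {q} n f lip r = ≤-trans (*-monoʳ-≤ α tail≤S₂) (+-cancelˡ-≤ (K * S₂) _ _ (begin
    K * S₂ + α * S₂         ≡⟨ *-distribʳ-+ S₂ K α ⟨
    (K + α) * S₂            ≡⟨ cong (_* S₂) K+α≡m ⟩
    m * S₂                  ≤⟨ lipschitz-variance n f lip ⟩
    S₁ * S₁ + n * (m * m)   ≤⟨ +-monoˡ-≤ (n * (m * m)) (sum-sq≤support g) ⟩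
    K * S₂ + n * (m * m)    ∎))
    where
    open ≤-Reasoning
    m = q ^ n
    g : Fin m → ℕ
    g k = f (point n k)
    S₁ = sum g
    S₂ = ∑[ k < m ] (g k * g k)
    K  = ∑[ k < m ] nonzero (g k)
    α  = ∑[ k < m ] iszero (g k)
    K+α≡m : K + α ≡ m
    K+α≡m = trans (sym (∑-distrib-+ (nonzero ∘ g) (iszero ∘ g)))
      (trans (sum-cong-≗ (λ k → complement (g k))) (trans (sum-const m 1) (*-identityʳ m)))
      where
      complement : ∀ x → nonzero x + iszero x ≡ 1
      complement zero    = refl
      complement (suc _) = refl
    -- Chebyshev's inequality about 0 instead of the mean: the zeros of `f` already bound its second
    -- moment.
    tail≤S₂ : ∑[ k < m ] ind (r ≤ᵇ g k) * (r * r) ≤ S₂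
    tail≤S₂ = ≤-trans (≤-reflexive (*-distribʳ-sum (r * r) (λ k → ind (r ≤ᵇ g k)))) (sum-mono λ k → pointwise (g k))
      where
      pointwise : ∀ x → ind (r ≤ᵇ x) * (r * r) ≤ x * x
      pointwise x with r ≤ᵇ x in eq
      ... | false = z≤n
      ... | true  = ≤-trans (≤-reflexive (+-identityʳ _)) (*-mono-≤ r≤x r≤x)
        where
        r≤x : r ≤ x
        r≤x = ≤ᵇ⇒≤ r x (subst T (sym eq) _)

  -- Distance to a set of vertices, and points whose translates are all near it.

  minimum : ℕ → (Fin N → ℕ) → ℕ
  minimum {zero}  b g = b
  minimum {suc N} b g = g zero ⊓ minimum b (g ∘ suc)

  minimum≤ : ∀ b (g : Fin N → ℕ) i → minimum b g ≤ g i
  minimum≤ b g zero    = m⊓n≤m _ _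
  minimum≤ b g (suc i) = ≤-trans (m⊓n≤n (g zero) _) (minimum≤ b (g ∘ suc) i)

  -- By `r ≤ b` the default `b` cannot be what pushes the minimum below `r`, so some `g i` is.
  minimum-attained : ∀ b r (g : Fin N → ℕ) → r ≤ b → minimum b g < r → ∃ λ i → g i < r
  minimum-attained {zero}  b r g r≤b lt = contradiction r≤b (<⇒≱ lt)
  minimum-attained {suc N} b r g r≤b lt with g zero <? r
  ... | yes h = zero , h
  ... | no  h with minimum b (g ∘ suc) <? r
  ...   | yes h′ with minimum-attained b r (g ∘ suc) r≤b h′
  ...     | i , gi<r = suc i , gi<r
  minimum-attained {suc N} b r g r≤b lt | no h | no h′ =
    contradiction lt (≤⇒≯ (⊓-glb (≮⇒≥ h) (≮⇒≥ h′)))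

  minimum-lipschitz : ∀ b (g h : Fin N → ℕ) d → (∀ i → g i ≤ h i + d) → minimum b g ≤ minimum b h + d
  minimum-lipschitz {zero}  b g h d gh = m≤m+n b d
  minimum-lipschitz {suc N} b g h d gh = ≤-trans
    (⊓-mono-≤ (gh zero) (minimum-lipschitz b (g ∘ suc) (h ∘ suc) d (gh ∘ suc)))
    (≤-reflexive (sym (+-distribʳ-⊓ d (h zero) _)))

  module _ (selected : Fin N → Bool) (position : Fin N → Vec (Fin q) n) where

    private
      -- No Hamming distance exceeds `n`, so an unselected vertex never undercuts a selected one;
      -- being constant in `x`, the value `n` also preserves the Lipschitz property.
      distanceTo : Vec (Fin q) n → Fin N → ℕ
      distanceTo x v = if selected v then hamming x (position v) else n

    -- The Hamming distance from x to the nearest selected position, capped at n.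
    distance : Vec (Fin q) n → ℕ
    distance x = minimum n (distanceTo x)

    distance-lipschitz : Lipschitz distance
    distance-lipschitz x y = minimum-lipschitz n (distanceTo x) (distanceTo y) (hamming x y) close
      where
      close : ∀ v → distanceTo x v ≤ distanceTo y v + hamming x y
      close v with selected v
      ... | true  = hamming-triangle x y (position v)
      ... | false = m≤m+n n _

    distance-position : ∀ v → selected v ≡ true → distance (position v) ≡ 0
    distance-position v sel = n≤0⇒n≡0 (≤-trans (minimum≤ n (distanceTo (position v)) v) (≤-reflexive zero-at))
      where
      zero-at : distanceTo (position v) v ≡ 0
      zero-at rewrite sel = hamming-refl (position v)

    distance-attained : ∀ {r} → r ≤ n → ∀ x → distance x < r →
      ∃ λ v → selected v ≡ true × hamming x (position v) < r
    distance-attained {r} r≤n x lt with minimum-attained n r (distanceTo x) r≤n lt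
    ... | v , h with selected v in sel
    ...   | true  = v , sel , h
    ...   | false = contradiction h (≤⇒≯ r≤n)

    -- Blow-up: all q translates of some point are within r of a set that is not too sparse,
    -- by a union bound over the translates.
    translates-near : .{{_ : NonZero q}} → ∀ {r} → r ≤ n →
      q * (n * q ^ n) < ∑[ k < q ^ n ] iszero (distance (point n k)) * (r * r) →
      ∃ λ x → ∀ (i : Fin q) → ∃ λ v → selected v ≡ true × hamming (map (rotate (toℕ i)) x) (position v) < r
    translates-near {r} r≤n dense with sum<n⇒∃≡0 failures few-failures
      where
      open ≤-Reasoning
      m = q ^ n
      failures : Fin m → ℕ
      failures k = ∑[ i < q ] ind (r ≤ᵇ distance (map (rotate (toℕ i)) (point n k)))
      α = ∑[ k < m ] iszero (distance (point n k))
      c = ∑[ k < m ] ind (r ≤ᵇ distance (point n k))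
      -- A translate of a uniform point is uniform, so each `i` contributes the same count `c`.
      sum-failures : sum failures ≡ q * c
      sum-failures = trans (∑-comm {m} {q} (λ k i → ind (r ≤ᵇ distance (map (rotate (toℕ i)) (point n k)))))
        (trans (sum-cong-≗ {q} λ i → sum-translate n (λ x → ind (r ≤ᵇ distance x)) (toℕ i)) (sum-const q c))
      few-failures : sum failures < m
      few-failures = ≰⇒> λ many → <⇒≱ dense (bound many)
        where
        arith : ∀ α q c r → q * (α * (c * (r * r))) ≡ (q * c) * (α * (r * r))
        arith = solve-∀
        arith′ : ∀ q n m → q * (n * (m * m)) ≡ m * (q * (n * m))
        arith′ = solve-∀
        -- The tail bound reads `α c r² ≤ n m²`, and a failure at every point would force `m ≤ q c`;
        -- multiplying the two and cancelling one `m` contradicts `dense`.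
        bound : m ≤ sum failures → α * (r * r) ≤ q * (n * m)
        bound many = *-cancelˡ-≤ m {{m^n≢0 q n}} (begin
          m * (α * (r * r))         ≤⟨ *-monoˡ-≤ (α * (r * r)) (≤-trans many (≤-reflexive sum-failures)) ⟩
          (q * c) * (α * (r * r))   ≡⟨ arith α q c r ⟨
          q * (α * (c * (r * r)))   ≤⟨ *-monoʳ-≤ q (lipschitz-tail n distance distance-lipschitz r) ⟩
          q * (n * (m * m))         ≡⟨ arith′ q n m ⟩
          m * (q * (n * m))         ∎)
    ... | k , none = point n k , λ i → distance-attained r≤n (map (rotate (toℕ i)) (point n k)) (near i)
      where
      near : ∀ i → distance (map (rotate (toℕ i)) (point n k)) < r
      near i with r ≤ᵇ distance (map (rotate (toℕ i)) (point n k)) in eq | sum≡0⇒≡0 {q} (λ i → ind (r ≤ᵇ distance (map (rotate (toℕ i)) (point n k)))) none i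
      ... | false | _ = ≰⇒> λ le → subst T eq (≤⇒≤ᵇ le)

-- Counting edges and subsets, the graphs, and their sparsity property.

module Construction where
  open Sums
  open Cube
  open import Data.Bool using (Bool; true; false; not; _∧_; _∨_; T)
  open import Data.Bool.Properties using (∧-conicalˡ; ∧-conicalʳ)
  open import Data.Fin using (Fin; zero; suc; toℕ; remQuot; inject≤; _≟_)
  open import Data.Fin.Properties using (any?; toℕ<n; toℕ-injective; toℕ-fromℕ<)
  open import Data.Fin.Subset using (Subset; _⊆_; _∈_; ∣_∣)
  open import Data.Nat using (ℕ; zero; suc; _+_; _*_; _∸_; _^_; _≤_; _<_; z≤n; s≤s; NonZero; _<ᵇ_; >-nonZero)
  open import Data.Nat.Combinatorics using (_C_; nC1≡n; nCk+nC[k+1]≡[n+1]C[k+1])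
  open import Data.Nat.DivMod using (_%_; m%n%n≡m%n; %-distribˡ-+; m<n⇒m%n≡m; [m+n]%n≡m%n)
  open import Data.Nat.Properties hiding (_≟_)
  open import Data.Nat.Tactic.RingSolver using (solve-∀)
  open import Data.Product using (∃; Σ-syntax; _×_; _,_; proj₁; proj₂)
  open import Data.Vec using (Vec; []; _∷_; lookup; map; tabulate; countᵇ)
  import Data.Vec as Vec
  open import Data.Vec.Properties using (lookup-map; []=⇒lookup; lookup⇒[]=; lookup∘tabulate)
  open import Function using (_∘_; id)
  open import Relation.Nullary using (does; yes; no; contradiction)
  open import Relation.Nullary.Decidable using (dec-false)
  open import Relation.Binary.PropositionalEquality

  private variable
    N : ℕ

  #ᵇ≡sum : (P : Fin N → Bool) → #ᵇ P ≡ ∑[ i < N ] ind (P i)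
  #ᵇ≡sum P = countᵇ-tabulate id
    where
    countᵇ-tabulate : ∀ {n} (g : Fin n → Fin _) → countᵇ P (tabulate g) ≡ ∑[ i < n ] ind (P (g i))
    countᵇ-tabulate {zero}  g = refl
    countᵇ-tabulate {suc n} g with P (g zero)
    ... | true  = cong suc (countᵇ-tabulate (g ∘ suc))
    ... | false = countᵇ-tabulate (g ∘ suc)

  ∣∣≡sum : (U : Subset N) → ∣ U ∣ ≡ ∑[ v < N ] ind (lookup U v)
  ∣∣≡sum []          = refl
  ∣∣≡sum (true ∷ U)  = cong suc (∣∣≡sum U)
  ∣∣≡sum (false ∷ U) = ∣∣≡sum U

  vec-sum≡sum : (f : Fin N → ℕ) → Vec.sum (tabulate f) ≡ sum f
  vec-sum≡sum {zero}  f = refl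
  vec-sum≡sum {suc N} f = cong (f zero +_) (vec-sum≡sum (f ∘ suc))

  ∀ᵇ⇒∀ : (P : Fin N → Bool) → ∀ᵇ P ≡ true → ∀ i → P i ≡ true
  ∀ᵇ⇒∀ P h zero with P zero
  ... | true = refl
  ∀ᵇ⇒∀ P h (suc i) with P zero
  ... | true = ∀ᵇ⇒∀ (P ∘ suc) h i

  edges≡sum : (adj : Fin N → Fin N → Bool) →
    edges adj ≡ ∑[ u < N ] ∑[ v < N ] ind ((toℕ u <ᵇ toℕ v) ∧ adj u v)
  edges≡sum adj = trans (vec-sum≡sum λ u → #ᵇ λ v → (toℕ u <ᵇ toℕ v) ∧ adj u v) (sum-cong-≗ λ u → #ᵇ≡sum (λ v → (toℕ u <ᵇ toℕ v) ∧ adj u v))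

  -- Exchanging the sums turns the second copy of the count into pairs with `v` below `u`; by
  -- symmetry of `adj` the two copies charge disjoint sets of ordered adjacent pairs.
  2*edges≤ : (adj : Fin N → Fin N → Bool) → (∀ u v → adj u v ≡ adj v u) →
    2 * edges adj ≤ ∑[ u < N ] ∑[ v < N ] ind (adj u v)
  2*edges≤ {N} adj symm = begin
    2 * edges adj                                       ≡⟨ cong (2 *_) (edges≡sum adj) ⟩
    2 * sum up                                          ≡⟨ cong (sum up +_) (+-identityʳ (sum up)) ⟩
    sum up + sum up                                     ≡⟨ cong (sum up +_) (∑-comm {N} {N} (λ u v → below u v)) ⟩
    sum up + sum down                                   ≡⟨ ∑-distrib-+ up down ⟨
    ∑[ u < N ] (up u + down u)                          ≡⟨ sum-cong-≗ {N} (λ u → ∑-distrib-+ {N} (below u) (λ v → below v u)) ⟨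
    ∑[ u < N ] ∑[ v < N ] (below u v + below v u)       ≤⟨ sum-mono {N} (λ u → sum-mono {N} (once u)) ⟩
    ∑[ u < N ] ∑[ v < N ] ind (adj u v)                 ∎
    where
    open ≤-Reasoning
    below : Fin N → Fin N → ℕ
    below u v = ind ((toℕ u <ᵇ toℕ v) ∧ adj u v)
    up down : Fin N → ℕ
    up   u = ∑[ v < N ] below u v
    down u = ∑[ v < N ] below v u
    once : ∀ u v → below u v + below v u ≤ ind (adj u v)
    once u v rewrite symm v u with toℕ u <ᵇ toℕ v in u<v | toℕ v <ᵇ toℕ u in v<u
    ... | true  | true  = contradiction (<ᵇ⇒< _ _ (subst T (sym v<u) _)) (<-asym (<ᵇ⇒< (toℕ u) (toℕ v) (subst T (sym u<v) _)))
    ... | true  | false = ≤-reflexive (+-identityʳ _)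
    ... | false | true  = ≤-refl
    ... | false | false = z≤n

  -- Pascal's rule: vertex 0 precedes the `N` others, and the remaining rows are the count for `N`.
  sum-pairs<≡C2 : ∀ N → ∑[ u < N ] ∑[ v < N ] ind (toℕ u <ᵇ toℕ v) ≡ N C 2
  sum-pairs<≡C2 zero    = refl
  sum-pairs<≡C2 (suc N) = begin
    ∑[ v < N ] 1 + ∑[ u < N ] ∑[ v < N ] ind (toℕ u <ᵇ toℕ v) ≡⟨ cong₂ _+_ (trans (sum-const N 1) (*-identityʳ N)) (sum-pairs<≡C2 N) ⟩
    N + N C 2                                                  ≡⟨ cong (_+ N C 2) (nC1≡n N) ⟨
    N C 1 + N C 2                                              ≡⟨ nCk+nC[k+1]≡[n+1]C[k+1] N 1 ⟩
    suc N C 2                                                  ∎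
    where open ≡-Reasoning

  2*C2 : ∀ N → 2 * (suc N C 2) ≡ suc N * N
  2*C2 zero    = refl
  2*C2 (suc N) = begin
    2 * (suc (suc N) C 2)            ≡⟨ cong (2 *_) (nCk+nC[k+1]≡[n+1]C[k+1] (suc N) 1) ⟨
    2 * (suc N C 1 + suc N C 2)      ≡⟨ *-distribˡ-+ 2 (suc N C 1) _ ⟩
    2 * (suc N C 1) + 2 * (suc N C 2) ≡⟨ cong₂ _+_ (cong (2 *_) (nC1≡n (suc N))) (2*C2 N) ⟩
    2 * suc N + suc N * N            ≡⟨ arith N ⟩
    suc (suc N) * suc N              ∎
    where
    open ≡-Reasoning
    arith : ∀ n → 2 * suc n + suc n * n ≡ suc (suc n) * suc n
    arith = solve-∀

  rotate-injective : ∀ {q} .{{_ : NonZero q}} (a i j : Fin q) → rotate (toℕ i) a ≡ rotate (toℕ j) a → i ≡ j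
  rotate-injective {q} a i j e = toℕ-injective (trans (sym (unshift i)) (trans (cong (λ x → (x + (q ∸ toℕ a)) % q) same) (unshift j)))
    where
    open ≡-Reasoning
    same : (toℕ i + toℕ a) % q ≡ (toℕ j + toℕ a) % q
    same = trans (sym (toℕ-fromℕ< _)) (trans (cong toℕ e) (toℕ-fromℕ< _))
    unshift : ∀ i → ((toℕ i + toℕ a) % q + (q ∸ toℕ a)) % q ≡ toℕ i
    unshift i = begin
      ((toℕ i + toℕ a) % q + (q ∸ toℕ a)) % q           ≡⟨ %-distribˡ-+ ((toℕ i + toℕ a) % q) (q ∸ toℕ a) q ⟩
      ((toℕ i + toℕ a) % q % q + (q ∸ toℕ a) % q) % q   ≡⟨ cong (λ x → (x + (q ∸ toℕ a) % q) % q) (m%n%n≡m%n (toℕ i + toℕ a) q) ⟩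
      ((toℕ i + toℕ a) % q + (q ∸ toℕ a) % q) % q       ≡⟨ %-distribˡ-+ (toℕ i + toℕ a) (q ∸ toℕ a) q ⟨
      (toℕ i + toℕ a + (q ∸ toℕ a)) % q                 ≡⟨ cong (_% q) (+-assoc (toℕ i) (toℕ a) (q ∸ toℕ a)) ⟩
      (toℕ i + (toℕ a + (q ∸ toℕ a))) % q               ≡⟨ cong (λ x → (toℕ i + x) % q) (m+[n∸m]≡n (<⇒≤ (toℕ<n a))) ⟩
      (toℕ i + q) % q                                   ≡⟨ [m+n]%n≡m%n (toℕ i) q ⟩
      toℕ i % q                                         ≡⟨ m<n⇒m%n≡m (toℕ<n i) ⟩
      toℕ i                                             ∎

  image : ∀ {q} → (Fin q → Fin N) → Subset N
  image σ = tabulate λ v → does (any? λ i → v ≟ σ i)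

  module _ {q} (σ : Fin q → Fin N) where

    ∈-image : ∀ {v} → lookup (image σ) v ≡ true → ∃ λ i → v ≡ σ i
    ∈-image {v} h with any? (λ i → v ≟ σ i) | trans (sym (lookup∘tabulate (λ v → does (any? λ i → v ≟ σ i)) v)) h
    ... | yes found | _ = found

    ∣image∣ : (∀ {i j} → σ i ≡ σ j → i ≡ j) → ∣ image σ ∣ ≡ q
    ∣image∣ inj = begin
      ∣ image σ ∣                                       ≡⟨ ∣∣≡sum (image σ) ⟩
      ∑[ v < N ] ind (lookup (image σ) v)               ≡⟨ sum-cong-≗ {N} indicator ⟩
      ∑[ v < N ] ∑[ i < q ] ind (does (v ≟ σ i))        ≡⟨ ∑-comm {N} {q} (λ v i → ind (does (v ≟ σ i))) ⟩
      ∑[ i < q ] ∑[ v < N ] ind (does (v ≟ σ i))        ≡⟨ sum-cong-≗ {q} (λ i → sum-cong-≗ {N} λ v → *-identityʳ (ind (does (v ≟ σ i)))) ⟨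
      ∑[ i < q ] ∑[ v < N ] (ind (does (v ≟ σ i)) * 1)  ≡⟨ sum-cong-≗ {q} (λ i → sum-δ (σ i) (λ _ → 1)) ⟩
      ∑[ i < q ] 1                                      ≡⟨ trans (sum-const q 1) (*-identityʳ q) ⟩
      q                                                 ∎
      where
      open ≡-Reasoning
      indicator : ∀ v → ind (lookup (image σ) v) ≡ ∑[ i < q ] ind (does (v ≟ σ i))
      indicator v rewrite lookup∘tabulate (λ v → does (any? λ i → v ≟ σ i)) v with any? (λ i → v ≟ σ i)
      ... | yes (i , refl) = sym (begin
        ∑[ j < q ] ind (does (σ i ≟ σ j))        ≡⟨ sum-cong-≗ {q} same ⟩
        ∑[ j < q ] (ind (does (j ≟ i)) * 1)      ≡⟨ sum-δ i (λ _ → 1) ⟩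
        1                                        ∎)
        where
        same : ∀ j → ind (does (σ i ≟ σ j)) ≡ ind (does (j ≟ i)) * 1
        same j with j ≟ i
        ... | yes refl rewrite ≟-refl (σ i) = refl
        ... | no j≢i with σ i ≟ σ j
        ...   | yes e = contradiction (sym (inj e)) j≢i
        ...   | no _  = refl
      ... | no none = sym (trans (sum-cong-≗ {q} λ i → cong ind (dec-false (v ≟ σ i) λ e → none (i , e)))
        (trans (sum-const q 0) (*-zeroʳ q)))

    ∣⊆image∣≤ : (T : Subset N) → T ⊆ image σ → ∣ T ∣ ≤ ∑[ i < q ] ind (lookup T (σ i))
    ∣⊆image∣≤ T T⊆ = begin
      ∣ T ∣                                                             ≡⟨ ∣∣≡sum T ⟩
      ∑[ v < N ] ind (lookup T v)                                       ≤⟨ sum-mono {N} covered ⟩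
      ∑[ v < N ] ∑[ i < q ] (ind (does (v ≟ σ i)) * ind (lookup T v))   ≡⟨ ∑-comm {N} {q} (λ v i → ind (does (v ≟ σ i)) * ind (lookup T v)) ⟩
      ∑[ i < q ] ∑[ v < N ] (ind (does (v ≟ σ i)) * ind (lookup T v))   ≡⟨ sum-cong-≗ {q} (λ i → sum-δ (σ i) (λ v → ind (lookup T v))) ⟩
      ∑[ i < q ] ind (lookup T (σ i))                                   ∎
      where
      open ≤-Reasoning
      covered : ∀ v → ind (lookup T v) ≤ ∑[ i < q ] (ind (does (v ≟ σ i)) * ind (lookup T v))
      covered v with lookup T v in v∈T
      ... | false = z≤n
      ... | true with ∈-image ([]=⇒lookup (T⊆ (lookup⇒[]= v T v∈T)))
      ...   | i , refl = ≤-trans (≤-reflexive (sym (trans (*-identityʳ _) (cong ind (≟-refl (σ i))))))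
        (term≤sum (λ j → ind (does (σ i ≟ σ j)) * 1) i)

  -- N ≤ L qⁿ n lets the N vertices be spread over the qⁿ n types (x , j), at most L on each.
  module _ (p {q} n L : ℕ) .{{_ : NonZero q}} (N≤ : N ≤ L * (q ^ n * n)) where

    private
      m = q ^ n

      type : Fin N → Fin m × Fin n
      type v = remQuot {m} n (proj₂ (remQuot {L} (m * n) (inject≤ v N≤)))

    position : Fin N → Vec (Fin q) n
    position v = point n (proj₁ (type v))

    index : Fin N → Fin n
    index v = proj₂ (type v)

    private
      -- Each endpoint is read at the coordinate named by the other, which makes the colour
      -- symmetric. It is reduced modulo `q` only after `f` has been added.
      colour : Fin N → Fin N → ℕ
      colour u v = toℕ (lookup (position u) (index v)) + toℕ (lookup (position v) (index u))

    G : Fin q → Fin N → Fin N → Bool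
    G f u v = not (does (u ≟ v)) ∧ ((colour u v + toℕ f) % q <ᵇ p)

    G-symmetric : ∀ f u v → G f u v ≡ G f v u
    G-symmetric f u v = cong₂ _∧_ (cong not ≟-sym)
      (cong (λ s → (s + toℕ f) % q <ᵇ p) (+-comm (toℕ (lookup (position u) (index v))) _))
      where
      ≟-sym : does (u ≟ v) ≡ does (v ≟ u)
      ≟-sym with u ≟ v
      ... | yes refl = sym (≟-refl u)
      ... | no u≢v   = sym (dec-false (v ≟ u) (u≢v ∘ sym))

    G-isGraph : ∀ f → IsGraph (G f)
    G-isGraph f = record
      { symmetric   = G-symmetric f
      ; irreflexive = λ v → cong (λ b → not b ∧ ((colour v v + toℕ f) % q <ᵇ p)) (≟-refl v)
      }

    module _ (p≤q : p ≤ q) where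

      G-exactly-p : ∀ u v → u ≢ v → #ᵇ (λ f → G f u v) ≡ p
      G-exactly-p u v u≢v = trans (#ᵇ≡sum (λ f → G f u v)) (trans
        (sum-cong-≗ {q} λ f → cong (λ b → ind (not b ∧ ((colour u v + toℕ f) % q <ᵇ p))) (dec-false (u ≟ v) u≢v))
        (count-window p≤q (colour u v)))

      sum-edges : ∑[ f < q ] edges (G f) ≡ p * (N C 2)
      sum-edges = begin
        ∑[ f < q ] edges (G f)
          ≡⟨ sum-cong-≗ {q} (λ f → edges≡sum (G f)) ⟩
        ∑[ f < q ] ∑[ u < N ] ∑[ v < N ] below f u v
          ≡⟨ ∑-comm {q} {N} (λ f u → ∑[ v < N ] below f u v) ⟩
        ∑[ u < N ] ∑[ f < q ] ∑[ v < N ] below f u v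
          ≡⟨ sum-cong-≗ {N} (λ u → trans (∑-comm {q} {N} (λ f v → below f u v))
              (trans (sum-cong-≗ {N} (pair u)) (sym (*-distribˡ-sum {N} p (λ v → ind (toℕ u <ᵇ toℕ v)))))) ⟩
        ∑[ u < N ] (p * ∑[ v < N ] ind (toℕ u <ᵇ toℕ v))
          ≡⟨ *-distribˡ-sum {N} p (λ u → ∑[ v < N ] ind (toℕ u <ᵇ toℕ v)) ⟨
        p * ∑[ u < N ] ∑[ v < N ] ind (toℕ u <ᵇ toℕ v)
          ≡⟨ cong (p *_) (sum-pairs<≡C2 N) ⟩
        p * (N C 2) ∎
        where
        open ≡-Reasoning
        below : Fin q → Fin N → Fin N → ℕ
        below f u v = ind ((toℕ u <ᵇ toℕ v) ∧ G f u v)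
        pair : ∀ u v → ∑[ f < q ] below f u v ≡ p * ind (toℕ u <ᵇ toℕ v)
        pair u v with toℕ u <ᵇ toℕ v in u<v
        ... | false = trans (sum-const q 0) (trans (*-zeroʳ q) (sym (*-zeroʳ p)))
        ... | true  = trans (sym (#ᵇ≡sum (λ f → G f u v))) (trans
          (G-exactly-p u v (λ { refl → <-irrefl refl (<ᵇ⇒< (toℕ u) (toℕ u) (subst T (sym u<v) _)) })) (sym (*-identityʳ p)))

    -- Embedding the vertices into `L` full copies of the set of types can only add terms. All upper
    -- bounds on vertex counts pass through this.
    sum-types : (h : Vec (Fin q) n → Fin n → ℕ) →
      ∑[ v < N ] h (position v) (index v) ≤ L * ∑[ k < m ] ∑[ j < n ] h (point n k) j
    sum-types h = begin
      ∑[ v < N ] h (position v) (index v)           ≤⟨ sum-inject≤ (λ v → atType (proj₂ (remQuot {L} (m * n) v))) N≤ ⟩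
      ∑[ v < L * (m * n) ] atType (proj₂ (remQuot {L} (m * n) v)) ≡⟨ sum-remQuot L (m * n) (atType ∘ proj₂) ⟩
      ∑[ l < L ] ∑[ t < m * n ] atType t            ≡⟨ sum-const L (∑[ t < m * n ] atType t) ⟩
      L * ∑[ t < m * n ] atType t                   ≡⟨ cong (L *_) (sum-remQuot m n (λ kj → h (point n (proj₁ kj)) (proj₂ kj))) ⟩
      L * ∑[ k < m ] ∑[ j < n ] h (point n k) j     ∎
      where
      open ≤-Reasoning
      atType : Fin (m * n) → ℕ
      atType t = h (point n (proj₁ (remQuot {m} n t))) (proj₂ (remQuot {m} n t))

    module _ (p≤q : p ≤ q) (f : Fin q) where

      -- For fixed `u` and fixed index `j` of the other endpoint, the colour depends only on that
      -- endpoint's coordinate `index u`. Over all types this coordinate is uniform, and `p` of its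
      -- `q` values hit the window.
      degree-bound : ∀ u → q * ∑[ v < N ] ind (G f u v) ≤ L * (m * n) * p
      degree-bound u = begin
        q * ∑[ v < N ] ind (G f u v)                         ≤⟨ *-monoʳ-≤ q (sum-mono {N} λ v → ind-mono (∧-conicalʳ (not (does (u ≟ v))) _)) ⟩
        q * ∑[ v < N ] window (index v) (lookup (position v) (index u)) ≤⟨ *-monoʳ-≤ q (sum-types (λ x j → window j (lookup x (index u)))) ⟩
        q * (L * ∑[ k < m ] ∑[ j < n ] window j (lookup (point n k) (index u))) ≡⟨ cong (λ s → q * (L * s)) (∑-comm {m} {n} (λ k j → window j (lookup (point n k) (index u)))) ⟩
        q * (L * ∑[ j < n ] ∑[ k < m ] window j (lookup (point n k) (index u))) ≡⟨ arith q L _ ⟩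
        L * (q * ∑[ j < n ] ∑[ k < m ] window j (lookup (point n k) (index u))) ≡⟨ cong (L *_) (*-distribˡ-sum {n} q _) ⟩
        L * ∑[ j < n ] (q * ∑[ k < m ] window j (lookup (point n k) (index u))) ≡⟨ cong (L *_) (sum-cong-≗ {n} λ j → trans (sum-marginal (window j) (index u)) (cong (m *_) (sum-window j))) ⟩
        L * ∑[ j < n ] (m * p)                               ≡⟨ cong (L *_) (sum-const n (m * p)) ⟩
        L * (n * (m * p))                                    ≡⟨ arith′ L m n p ⟩
        L * (m * n) * p                                      ∎
        where
        open ≤-Reasoning
        window : Fin n → Fin q → ℕ
        window j a = ind ((toℕ (lookup (position u) j) + toℕ a + toℕ f) % q <ᵇ p)
        sum-window : ∀ j → sum (window j) ≡ p
        sum-window j = trans (sum-cong-≗ {q} λ a → cong (λ s → ind (s % q <ᵇ p)) (swap (toℕ (lookup (position u) j)) (toℕ a) (toℕ f)))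
          (count-window p≤q (toℕ (lookup (position u) j) + toℕ f))
          where
          swap : ∀ x y z → x + y + z ≡ x + z + y
          swap = solve-∀
        arith : ∀ q L s → q * (L * s) ≡ L * (q * s)
        arith = solve-∀
        arith′ : ∀ L m n p → L * (n * (m * p)) ≡ L * (m * n) * p
        arith′ = solve-∀

      edges-bound : q * (2 * edges (G f)) ≤ N * (L * (m * n) * p)
      edges-bound = begin
        q * (2 * edges (G f))                        ≤⟨ *-monoʳ-≤ q (2*edges≤ (G f) (G-symmetric f)) ⟩
        q * ∑[ u < N ] ∑[ v < N ] ind (G f u v)      ≡⟨ *-distribˡ-sum {N} q _ ⟩
        ∑[ u < N ] (q * ∑[ v < N ] ind (G f u v))    ≤⟨ sum-mono {N} degree-bound ⟩
        ∑[ u < N ] (L * (m * n) * p)                 ≡⟨ sum-const N _ ⟩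
        N * (L * (m * n) * p)                        ∎
        where open ≤-Reasoning

      -- At a coordinate where the positions of the σ i are the q translates of a single value,
      -- the colours of a common neighbour w towards the σ i exhaust ℤ/q, so w sees at most p of them.
      module _ (σ : Fin q → Fin N) (j : Fin n) (σ-index : ∀ i → index (σ i) ≡ j) (x : Vec (Fin q) n) where

        -- Summed over `c` this is the total Hamming distance of the `σ i` from their translates of
        -- `x`, hence small.
        defect : Fin n → ℕ
        defect c = ∑[ i < q ] differ (lookup (map (rotate (toℕ i)) x) c) (lookup (position (σ i)) c)

        defect-free : ∀ {c} → defect c ≡ 0 → ∀ i → lookup (position (σ i)) c ≡ rotate (toℕ i) (lookup x c)
        defect-free {c} none i = trans (sym (differ≡0⇒≡ _ _
          (sum≡0⇒≡0 (λ i → differ (lookup (map (rotate (toℕ i)) x) c) (lookup (position (σ i)) c)) none i)))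
          (lookup-map c (rotate (toℕ i)) x)

        -- At a single coordinate without defect the `q` positions already take distinct values.
        σ-injective : ∃ (λ c → defect c ≡ 0) → ∀ {i i′} → σ i ≡ σ i′ → i ≡ i′
        σ-injective (c , none) {i} {i′} e = rotate-injective (lookup x c) i i′
          (trans (sym (defect-free none i)) (trans (cong (λ v → lookup (position v) c) e) (defect-free none i′)))

        module _ (T : Subset N) (T⊆ : T ⊆ image σ) (∣T∣ : ∣ T ∣ ≡ suc p) where

          private
            common : Fin N → Bool
            common w = ∀ᵇ λ t → not (t ∈ᵇ T) ∨ G f t w

          common⇒defect : ∀ w → common w ≡ true → defect (index w) ≢ 0
          common⇒defect w all none = 1+n≰n (begin
            suc p                                       ≡⟨ ∣T∣ ⟨
            ∣ T ∣                                       ≤⟨ ∣⊆image∣≤ σ T T⊆ ⟩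
            ∑[ i < q ] ind (lookup T (σ i))             ≤⟨ sum-mono {q} (λ i → ind-mono (in-window i)) ⟩
            ∑[ i < q ] ind ((xc + y + toℕ f + toℕ i) % q <ᵇ p) ≡⟨ count-window p≤q (xc + y + toℕ f) ⟩
            p                                           ∎)
            where
            open ≤-Reasoning
            xc = toℕ (lookup x (index w))
            -- One `y` serves all `i` because the `σ i` share the index `j`; so `i` enters the
            -- colours only as a translation.
            y  = toℕ (lookup (position w) j)
            shift : ∀ i → (colour (σ i) w + toℕ f) % q ≡ (xc + y + toℕ f + toℕ i) % q
            shift i = begin-equality
              (colour (σ i) w + toℕ f) % q
                ≡⟨ cong₂ (λ a c → (toℕ a + toℕ (lookup (position w) c) + toℕ f) % q) (defect-free none i) (σ-index i) ⟩
              (toℕ (rotate (toℕ i) (lookup x (index w))) + y + toℕ f) % q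
                ≡⟨ cong (λ a → (a + y + toℕ f) % q) (toℕ-fromℕ< _) ⟩
              ((toℕ i + xc) % q + y + toℕ f) % q
                ≡⟨ cong (_% q) (+-assoc ((toℕ i + xc) % q) y (toℕ f)) ⟩
              ((toℕ i + xc) % q + (y + toℕ f)) % q
                ≡⟨ %-distribˡ-+ ((toℕ i + xc) % q) (y + toℕ f) q ⟩
              ((toℕ i + xc) % q % q + (y + toℕ f) % q) % q
                ≡⟨ cong (λ a → (a + (y + toℕ f) % q) % q) (m%n%n≡m%n (toℕ i + xc) q) ⟩
              ((toℕ i + xc) % q + (y + toℕ f) % q) % q
                ≡⟨ %-distribˡ-+ (toℕ i + xc) (y + toℕ f) q ⟨
              (toℕ i + xc + (y + toℕ f)) % q
                ≡⟨ cong (_% q) (arith (toℕ i) xc y (toℕ f)) ⟩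
              (xc + y + toℕ f + toℕ i) % q ∎
              where
              arith : ∀ i a y f → i + a + (y + f) ≡ a + y + f + i
              arith = solve-∀
            in-window : ∀ i → lookup T (σ i) ≡ true → ((xc + y + toℕ f + toℕ i) % q <ᵇ p) ≡ true
            in-window i i∈T = trans (cong (_<ᵇ p) (sym (shift i))) (∧-conicalʳ (not (does (σ i ≟ w))) _
              (subst (λ b → (not b ∨ G f (σ i) w) ≡ true) i∈T (∀ᵇ⇒∀ _ all (σ i))))

          -- A common neighbour has an index of defect at least 1, so it is paid for by that defect;
          -- each index occurs at most `L * m` times.
          commonNbrs-bound : commonNbrs (G f) T ≤ L * (m * ∑[ c < n ] defect c)
          commonNbrs-bound = begin
            commonNbrs (G f) T                          ≡⟨ #ᵇ≡sum common ⟩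
            ∑[ w < N ] ind (common w)                   ≤⟨ sum-mono {N} pointwise ⟩
            ∑[ w < N ] defect (index w)                 ≤⟨ sum-types (λ _ c → defect c) ⟩
            L * ∑[ k < m ] ∑[ c < n ] defect c          ≡⟨ cong (L *_) (sum-const m (∑[ c < n ] defect c)) ⟩
            L * (m * ∑[ c < n ] defect c)               ∎
            where
            open ≤-Reasoning
            pointwise : ∀ w → ind (common w) ≤ defect (index w)
            pointwise w with common w in all
            ... | false = z≤n
            ... | true  = n≢0⇒n>0 (common⇒defect w all)

      -- The total defect is at most `q r`, so any `p + 1` chosen vertices have at most `L m q r`
      -- common neighbours. This is below `L m n / (2k)`, hence below `N / k`.
      translates⇒sparse : ∀ {k r} (U : Subset N) j (x : Vec (Fin q) n) →
        (∀ (i : Fin q) → ∃ λ v → (lookup U v ≡ true × index v ≡ j) × hamming (map (rotate (toℕ i)) x) (position v) < r) →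
        1 ≤ N → 1 ≤ k → L * (m * n) ≤ 2 * N → 2 * k * q * r < n →
        Σ[ S ∈ Subset N ] (S ⊆ U × ∣ S ∣ ≡ q ×
          (∀ T → T ⊆ S → ∣ T ∣ ≡ suc p → k * commonNbrs (G f) T < N))
      translates⇒sparse {k} {r} U j x near 1≤N 1≤k LM≤2N 2kqr<n =
        -- Since the defects sum to less than `n`, some coordinate has none; this makes `σ`
        -- injective and gives the image its full size `q`.
        image σ , S⊆U , ∣image∣ σ (σ-injective σ j σ-index x (sum<n⇒∃≡0 defects (≤-<-trans defects≤ (≤-<-trans qr≤2kqr 2kqr<n)))) , few
        where
        open ≤-Reasoning
        instance
          m≢0 : NonZero m
          m≢0 = m^n≢0 q n
          2k≢0 : NonZero (2 * k)
          2k≢0 = m*n≢0 2 k {{_}} {{>-nonZero 1≤k}}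
          Lm≢0 : NonZero (L * m)
          Lm≢0 = m*n≢0 L m {{m*n≢0⇒m≢0 L {{>-nonZero (≤-trans 1≤N N≤)}}}}

        σ : Fin q → Fin N
        σ i = proj₁ (near i)

        σ-index : ∀ i → index (σ i) ≡ j
        σ-index i = proj₂ (proj₁ (proj₂ (near i)))

        S⊆U : image σ ⊆ U
        S⊆U {v} v∈S with ∈-image σ ([]=⇒lookup v∈S)
        ... | i , refl = lookup⇒[]= v U (proj₁ (proj₁ (proj₂ (near i))))

        defects : Fin n → ℕ
        defects = defect σ j σ-index x

        defects≤ : sum defects ≤ q * r
        defects≤ = begin
          sum defects                                                        ≡⟨ ∑-comm {n} {q} (λ c i → differ (lookup (map (rotate (toℕ i)) x) c) (lookup (position (σ i)) c)) ⟩
          ∑[ i < q ] hamming (map (rotate (toℕ i)) x) (position (σ i))       ≤⟨ sum-mono {q} (λ i → <⇒≤ (proj₂ (proj₂ (near i)))) ⟩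
          ∑[ i < q ] r                                                       ≡⟨ sum-const q r ⟩
          q * r                                                              ∎

        qr≤2kqr : q * r ≤ 2 * k * q * r
        qr≤2kqr = *-monoˡ-≤ r (m≤n*m q (2 * k))

        few : ∀ T → T ⊆ image σ → ∣ T ∣ ≡ suc p → k * commonNbrs (G f) T < N
        few T T⊆ ∣T∣ = *-cancelˡ-< 2 _ _ (begin-strict
          2 * (k * commonNbrs (G f) T)          ≤⟨ *-monoʳ-≤ 2 (*-monoʳ-≤ k (commonNbrs-bound σ j σ-index x T T⊆ ∣T∣)) ⟩
          2 * (k * (L * (m * sum defects)))     ≤⟨ *-monoʳ-≤ 2 (*-monoʳ-≤ k (*-monoʳ-≤ L (*-monoʳ-≤ m defects≤))) ⟩
          2 * (k * (L * (m * (q * r))))         ≡⟨ arith₁ k L m q r ⟩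
          L * m * (2 * k * q * r)               <⟨ *-monoʳ-< (L * m) 2kqr<n ⟩
          L * m * n                             ≡⟨ *-assoc L m n ⟩
          L * (m * n)                           ≤⟨ LM≤2N ⟩
          2 * N                                 ∎)
          where
          arith₁ : ∀ k L m q r → 2 * (k * (L * (m * (q * r)))) ≡ L * m * (2 * k * q * r)
          arith₁ = solve-∀

      -- Splitting `U` by index and keeping the index with the most occupied points leaves a set of
      -- positions dense enough for `translates-near`, all belonging to vertices of one index.
      blowup : ∀ {k r} (U : Subset N) → 1 ≤ N → 1 ≤ k → L * (m * n) ≤ 2 * N → r ≤ n →
        2 * k * q * n < r * r → 2 * k * q * r < n → N ≤ k * ∣ U ∣ →
        Σ[ S ∈ Subset N ] (S ⊆ U × ∣ S ∣ ≡ q ×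
          (∀ T → T ⊆ S → ∣ T ∣ ≡ suc p → k * commonNbrs (G f) T < N))
      blowup {k} {r} U 1≤N 1≤k LM≤2N r≤n 2kqn<r² 2kqr<n N≤kU =
        translates⇒sparse U j (proj₁ translates) (λ i → let v , sel , close = proj₂ translates i in v , selected⇒ sel , close) 1≤N 1≤k LM≤2N 2kqr<n
        where
        open ≤-Reasoning
        instance
          m≢0 : NonZero m
          m≢0 = m^n≢0 q n
          n≢0 : NonZero n
          n≢0 = >-nonZero (≤-<-trans z≤n 2kqr<n)
          k≢0 : NonZero k
          k≢0 = >-nonZero 1≤k
          2k≢0 : NonZero (2 * k)
          2k≢0 = m*n≢0 2 k
          Ln≢0 : NonZero (L * n)
          Ln≢0 = m*n≢0 L n {{m*n≢0⇒m≢0 L {{>-nonZero (≤-trans 1≤N N≤)}}}}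

        selected : Fin n → Fin N → Bool
        selected j v = lookup U v ∧ does (index v ≟ j)
        Z : Fin n → ℕ
        Z j = ∑[ k < m ] iszero (distance (selected j) position (point n k))

        ∣U∣≤ : ∣ U ∣ ≤ L * sum Z
        ∣U∣≤ = begin
          ∣ U ∣                                 ≡⟨ ∣∣≡sum U ⟩
          ∑[ v < N ] ind (lookup U v)           ≤⟨ sum-mono {N} at-distance-0 ⟩
          ∑[ v < N ] iszero (distance (selected (index v)) position (position v)) ≤⟨ sum-types (λ x j → iszero (distance (selected j) position x)) ⟩
          L * ∑[ k < m ] ∑[ j < n ] iszero (distance (selected j) position (point n k)) ≡⟨ cong (L *_) (∑-comm {m} {n} (λ k j → iszero (distance (selected j) position (point n k)))) ⟩
          L * sum Z                             ∎
          where
          at-distance-0 : ∀ v → ind (lookup U v) ≤ iszero (distance (selected (index v)) position (position v))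
          at-distance-0 v with lookup U v in v∈U
          ... | false = z≤n
          ... | true  = ≤-reflexive (cong iszero (sym (distance-position (selected (index v)) position v
            (cong₂ _∧_ v∈U (≟-refl (index v))))))

        richest : ∃ λ j → sum Z ≤ n * Z j
        richest = ∃-above-average Z

        j = proj₁ richest

        -- The positions of index `j` fill at least a `1/(2k)` part of the cube: `k` is lost to the
        -- size of `U`, and 2 to the types that carry fewer than `L` vertices.
        m≤2kZ : m ≤ 2 * k * Z j
        m≤2kZ = *-cancelˡ-≤ (L * n) (begin
          L * n * m                      ≡⟨ arith₁ L n m ⟩
          L * (m * n)                    ≤⟨ LM≤2N ⟩
          2 * N                          ≤⟨ *-monoʳ-≤ 2 (≤-trans N≤kU (*-monoʳ-≤ k (≤-trans ∣U∣≤ (*-monoʳ-≤ L (proj₂ richest))))) ⟩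
          2 * (k * (L * (n * Z j)))      ≡⟨ arith₂ k L n (Z j) ⟩
          L * n * (2 * k * Z j)          ∎)
          where
          arith₁ : ∀ L n m → L * n * m ≡ L * (m * n)
          arith₁ = solve-∀
          arith₂ : ∀ k L n z → 2 * (k * (L * (n * z))) ≡ L * n * (2 * k * z)
          arith₂ = solve-∀

        dense : q * (n * m) < Z j * (r * r)
        dense = *-cancelˡ-< (2 * k) _ _ (begin-strict
          2 * k * (q * (n * m))          ≡⟨ arith₁ k q n m ⟩
          2 * k * q * n * m              <⟨ *-monoˡ-< m 2kqn<r² ⟩
          r * r * m                      ≤⟨ *-monoʳ-≤ (r * r) m≤2kZ ⟩
          r * r * (2 * k * Z j)          ≡⟨ arith₂ r k (Z j) ⟩
          2 * k * (Z j * (r * r))        ∎)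
          where
          arith₁ : ∀ k q n m → 2 * k * (q * (n * m)) ≡ 2 * k * q * n * m
          arith₁ = solve-∀
          arith₂ : ∀ r k z → r * r * (2 * k * z) ≡ 2 * k * (z * (r * r))
          arith₂ = solve-∀

        translates : ∃ λ x → ∀ (i : Fin q) → ∃ λ v → selected j v ≡ true × hamming (map (rotate (toℕ i)) x) (position v) < r
        translates = translates-near (selected j) position r≤n dense

        selected⇒ : ∀ {v} → selected j v ≡ true → lookup U v ≡ true × index v ≡ j
        selected⇒ {v} sel with index v ≟ j | ∧-conicalʳ (lookup U v) _ sel
        ... | yes e | _ = ∧-conicalˡ _ _ sel , e

-- Densities, choice of parameters, and the theorem in integer form.

module Combinatorial where
  open Sums
  open Construction
  open import Data.Bool using (Bool)
  open import Data.Fin using (Fin)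
  open import Data.Fin.Subset using (Subset; _⊆_; ∣_∣)
  open import Data.Nat using (ℕ; suc; _+_; _*_; _^_; _≤_; _<_; z≤n; s≤s; NonZero; >-nonZero)
  open import Data.Nat.Combinatorics using (_C_)
  open import Data.Nat.DivMod using (_/_; m≡m%n+[m/n]*n; m%n<n; m/n*n≤m)
  open import Data.Nat.Properties
  open import Data.Nat.Tactic.RingSolver using (solve-∀)
  open import Data.Product using (Σ-syntax; ∃-syntax; _×_; _,_)
  open import Relation.Binary.PropositionalEquality

  suc[m/n]*n≤m+n : ∀ m n .{{_ : NonZero n}} → suc (m / n) * n ≤ m + n
  suc[m/n]*n≤m+n m n = ≤-trans (+-monoʳ-≤ n (m/n*n≤m m n)) (≤-reflexive (+-comm n m))

  m≤suc[m/n]*n : ∀ m n .{{_ : NonZero n}} → m ≤ suc (m / n) * n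
  m≤suc[m/n]*n m n = ≤-trans (≤-reflexive (m≡m%n+[m/n]*n m n)) (+-monoˡ-≤ (m / n * n) (<⇒≤ (m%n<n m n)))

  -- The cross-multiplied form of e / C(N,2) ≤ p/q + 1/(q k).
  density-upper : ∀ p q k M {e N A} → q * (2 * e) ≤ N * (A * p) → A ≤ N + M →
    k * p + k * M * p < N → e * q * k ≤ (p * k + 1) * (N C 2)
  density-upper p q k M {e} {suc N} {A} edges≤ A≤ (s≤s large) = *-cancelˡ-≤ 2 (begin
    2 * (e * q * k)                          ≡⟨ arith₁ e q k ⟩
    k * (q * (2 * e))                        ≤⟨ *-monoʳ-≤ k (≤-trans edges≤ (*-monoʳ-≤ (suc N) (*-monoˡ-≤ p A≤))) ⟩
    k * (suc N * ((suc N + M) * p))          ≡⟨ arith₂ k N M p ⟩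
    -- Two errors are absorbed here: `k * p` from comparing the square of the vertex count with
    -- twice the number of pairs, and `k * M * p` from the excess of `A` over the vertex count.
    suc N * (p * k * N + (k * p + k * M * p)) ≤⟨ *-monoʳ-≤ (suc N) (+-monoʳ-≤ (p * k * N) large) ⟩
    suc N * (p * k * N + N)                  ≡⟨ arith₃ p k N ⟩
    (p * k + 1) * (suc N * N)                ≡⟨ cong ((p * k + 1) *_) (2*C2 N) ⟨
    (p * k + 1) * (2 * (suc N C 2))          ≡⟨ arith₄ (p * k + 1) (suc N C 2) ⟩
    2 * ((p * k + 1) * (suc N C 2))          ∎)
    where
    open ≤-Reasoning
    arith₁ : ∀ e q k → 2 * (e * q * k) ≡ k * (q * (2 * e))
    arith₁ = solve-∀
    arith₂ : ∀ k N M p → k * (suc N * ((suc N + M) * p)) ≡ suc N * (p * k * N + (k * p + k * M * p))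
    arith₂ = solve-∀
    arith₃ : ∀ p k N → suc N * (p * k * N + N) ≡ (p * k + 1) * (suc N * N)
    arith₃ = solve-∀
    arith₄ : ∀ x c → x * (2 * c) ≡ 2 * (x * c)
    arith₄ = solve-∀

  -- The lower bound for one graph follows from the upper bounds for the other q − 1,
  -- because the q densities sum to p.
  density-lower : ∀ p q k c (e : Fin q → ℕ) → sum e ≡ p * c →
    (∀ f → e f * q * k ≤ (p * k + 1) * c) → ∀ f → p * c * k ≤ e f * q * k + q * c
  density-lower p q k c e total upper f = +-cancelˡ-≤ (q * (p * k * c)) _ _ (begin
    -- Only the `q − 1` other graphs contribute an excess of `c`; the added `c` rounds this up to
    -- `q * c`.
    q * (p * k * c) + p * c * k                    ≤⟨ m≤m+n _ c ⟩
    q * (p * k * c) + p * c * k + c                ≡⟨ arith₁ p q k c ⟩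
    p * c * (q * k) + (p * k + 1) * c              ≡⟨ cong (λ s → s * (q * k) + (p * k + 1) * c) total ⟨
    sum e * (q * k) + (p * k + 1) * c              ≡⟨ cong (_+ (p * k + 1) * c) scaled ⟩
    ∑[ g < q ] (e g * q * k) + (p * k + 1) * c     ≤⟨ sum-≤-one-exact (λ g → e g * q * k) upper f ⟩
    e f * q * k + q * ((p * k + 1) * c)            ≡⟨ arith₂ (e f * q * k) p q k c ⟩
    q * (p * k * c) + (e f * q * k + q * c)        ∎)
    where
    open ≤-Reasoning
    scaled : sum e * (q * k) ≡ ∑[ g < q ] (e g * q * k)
    scaled = trans (*-distribʳ-sum (q * k) e) (sum-cong-≗ λ g → sym (*-assoc (e g) q k))
    arith₁ : ∀ p q k c → q * (p * k * c) + p * c * k + c ≡ p * c * (q * k) + (p * k + 1) * c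
    arith₁ = solve-∀
    arith₂ : ∀ x p q k c → x + q * ((p * k + 1) * c) ≡ q * (p * k * c) + (x + q * c)
    arith₂ = solve-∀

  1≤C2 : ∀ {N} → 2 ≤ N → 1 ≤ N C 2
  1≤C2 {suc N} (s≤s 1≤N) = *-cancelˡ-< 2 0 (suc N C 2)
    (≤-trans (*-mono-≤ {1} {suc N} (s≤s z≤n) 1≤N) (≤-reflexive (sym (2*C2 N))))

  -- The conclusion of the theorem with densities cross-multiplied and 1/k in place of ε.
  Family : (p q k N : ℕ) → Set
  Family p q k N =
    Σ[ G ∈ (Fin q → Fin N → Fin N → Bool) ] ((∀ f → IsGraph (G f))
      × (∀ u v → u ≢ v → #ᵇ (λ f → G f u v) ≡ p)
      × 1 ≤ N C 2
      × (∀ f → (p * (N C 2) * k ≤ edges (G f) * q * k + q * (N C 2)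
             × edges (G f) * q * k ≤ p * (N C 2) * k + (N C 2) * q)
             × (∀ (U : Subset N) → N ≤ k * ∣ U ∣ → Σ[ S ∈ Subset N ] (S ⊆ U × ∣ S ∣ ≡ q
                 × (∀ T → T ⊆ S → ∣ T ∣ ≡ suc p → k * commonNbrs (G f) T < N)))))

  family : ∀ {p q k r} n L {N} → 1 ≤ p → p < q → 1 ≤ k → r ≤ n →
    2 * k * q * n < r * r → 2 * k * q * r < n →
    N ≤ L * (q ^ n * n) → L * (q ^ n * n) ≤ N + q ^ n * n →
    k * p + k * (q ^ n * n) * p < N → Family p q k N
  family {p} {q} {k} n L {N} 1≤p p<q 1≤k r≤n 2kqn<r² 2kqr<n N≤ LM≤N+M large =
    G p n L N≤ , G-isGraph p n L N≤ , G-exactly-p p n L N≤ p≤q , 1≤C2 2≤N ,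
    λ f → ( density-lower p q k (N C 2) (λ g → edges (G p n L N≤ g)) (sum-edges p n L N≤ p≤q) upper f
          -- The excess proved is `1/(q k)`, weakened here to `1/k`. The sharper form is what
          -- `density-lower` needs, where the excesses of the other graphs add up.
          , ≤-trans (upper f) (≤-trans (≤-reflexive (arith p k (N C 2))) (+-monoʳ-≤ (p * (N C 2) * k) (m≤m*n (N C 2) q))) )
          , λ U → blowup p n L N≤ p≤q f U (<⇒≤ 2≤N) 1≤k LM≤2N r≤n 2kqn<r² 2kqr<n
    where
    M = q ^ n * n
    p≤q : p ≤ q
    p≤q = <⇒≤ p<q
    instance
      q≢0 : NonZero q
      q≢0 = >-nonZero (≤-<-trans z≤n p<q)
      k≢0 : NonZero k
      k≢0 = >-nonZero 1≤k
      p≢0 : NonZero p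
      p≢0 = >-nonZero 1≤p
    M≤N : M ≤ N
    M≤N = begin
      M                    ≤⟨ m≤n*m M k ⟩
      k * M                ≤⟨ m≤m*n (k * M) p ⟩
      k * M * p            ≤⟨ m≤n+m _ (k * p) ⟩
      k * p + k * M * p    ≤⟨ <⇒≤ large ⟩
      N                    ∎
      where open ≤-Reasoning
    LM≤2N : L * M ≤ 2 * N
    LM≤2N = ≤-trans LM≤N+M (≤-trans (+-monoʳ-≤ N M≤N) (≤-reflexive (cong (N +_) (sym (+-identityʳ N)))))
    2≤N : 2 ≤ N
    2≤N = ≤-trans (s≤s (≤-trans (*-mono-≤ 1≤k 1≤p) (m≤m+n (k * p) (k * M * p)))) large
    upper : ∀ f → edges (G p n L N≤ f) * q * k ≤ (p * k + 1) * (N C 2)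
    upper f = density-upper p q k M {edges (G p n L N≤ f)} (edges-bound p n L N≤ p≤q f) LM≤N+M large
    arith : ∀ p k c → (p * k + 1) * c ≡ p * c * k + c
    arith = solve-∀

  graphs : ∀ p q k → 1 ≤ p → p < q → 1 ≤ k → ∃[ N₀ ] ∀ N → N₀ ≤ N → Family p q k N
  graphs p q k 1≤p p<q 1≤k = suc (k * p + k * M * p) , λ N N₀≤N →
    family n (suc (N / M)) 1≤p p<q 1≤k r≤n Kn<r² ≤-refl (m≤suc[m/n]*n N M) (suc[m/n]*n≤m+n N M) N₀≤N
    where
    K r n M : ℕ
    -- The demands are `K n < r²` (concentration) and `K r < n` (few defects). The least `n` for the
    -- second is `K r + 1`; the first becomes `K² r + K < r²`, whose least solution is `r = K² + 1`.
    K = 2 * k * q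
    r = suc (K * K)
    n = suc (K * r)
    M = q ^ n * n
    instance
      q≢0 : NonZero q
      q≢0 = >-nonZero (≤-<-trans z≤n p<q)
      k≢0 : NonZero k
      k≢0 = >-nonZero 1≤k
      K≢0 : NonZero K
      K≢0 = m*n≢0 (2 * k) q {{m*n≢0 2 k}}
      M≢0 : NonZero M
      M≢0 = m*n≢0 (q ^ n) n {{m^n≢0 q n}}
    r≤n : r ≤ n
    r≤n = ≤-trans (m≤n*m r K) (n≤1+n (K * r))
    Kn<r² : K * n < r * r
    Kn<r² = begin-strict
      K * suc (K * r)       ≡⟨ arith K r ⟩
      K + K * K * r         <⟨ +-monoˡ-< (K * K * r) (s≤s (m≤m*n K K)) ⟩
      r + K * K * r         ∎
      where
      open ≤-Reasoning
      arith : ∀ K r → K * suc (K * r) ≡ K + K * K * r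
      arith = solve-∀

-- From natural-number inequalities to rational ones.

module Ratios where
  open import Data.Integer as ℤ using (+_; -[1+_]; +≤+; +<+)
  open import Data.Integer.Properties as ℤ using (pos-*; pos-+; drop‿+≤+)
  open import Data.Nat as ℕ using (ℕ; suc; s≤s; z≤n)
  import Data.Nat.Properties as ℕ
  open import Data.Product using (∃; _×_; _,_)
  open import Data.Rational
  open import Data.Rational.Properties
  open import Data.Rational.Unnormalised as ℚᵘ using (ℚᵘ; mkℚᵘ)
  import Data.Rational.Unnormalised.Properties as ℚᵘ
  open import Relation.Binary.PropositionalEquality

  /-cross-≤ : ∀ {a b c d} → a ℕ.* suc d ℕ.≤ c ℕ.* suc b → mkℚᵘ (+ a) b ℚᵘ.≤ mkℚᵘ (+ c) d
  /-cross-≤ {a} {b} {c} {d} h = ℚᵘ.*≤* (subst₂ ℤ._≤_ (pos-* a (suc d)) (pos-* c (suc b)) (+≤+ h))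

  cross-≤-/ : ∀ {a b c d} → mkℚᵘ (+ a) b ℚᵘ.≤ mkℚᵘ (+ c) d → a ℕ.* suc d ℕ.≤ c ℕ.* suc b
  cross-≤-/ {a} {b} {c} {d} (ℚᵘ.*≤* h) = drop‿+≤+ (subst₂ ℤ._≤_ (sym (pos-* a (suc d))) (sym (pos-* c (suc b))) h)

  -- The odd-looking denominator field is the predecessor of `suc b * suc d` as that product
  -- computes.
  +ᵘ-pos : ∀ a b c d → mkℚᵘ (+ a) b ℚᵘ.+ mkℚᵘ (+ c) d ≡ mkℚᵘ (+ (a ℕ.* suc d ℕ.+ c ℕ.* suc b)) (d ℕ.+ b ℕ.* suc d)
  +ᵘ-pos a b c d = cong (λ z → mkℚᵘ z (d ℕ.+ b ℕ.* suc d)) (begin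
    + a ℤ.* + suc d ℤ.+ + c ℤ.* + suc b        ≡⟨ cong₂ ℤ._+_ (pos-* a (suc d)) (pos-* c (suc b)) ⟨
    + (a ℕ.* suc d) ℤ.+ + (c ℕ.* suc b)        ≡⟨ pos-+ (a ℕ.* suc d) (c ℕ.* suc b) ⟨
    + (a ℕ.* suc d ℕ.+ c ℕ.* suc b)            ∎)
    where open ≡-Reasoning

  -- ε ≥ 1/k, in the two forms that the theorem consumes.
  record Reciprocal (ε : ℚ) (k : ℕ) : Set where
    field
      k≥1      : 1 ℕ.≤ k
      ≤-scale  : ∀ {N a} → ε * ℕ→ℚ N ≤ ℕ→ℚ a → N ℕ.≤ k ℕ.* a
      ratio-≤  : ∀ {a b c d} → 1 ℕ.≤ b → 1 ℕ.≤ d →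
        a ℕ.* d ℕ.* k ℕ.≤ c ℕ.* b ℕ.* k ℕ.+ b ℕ.* d → ratio a b ≤ ratio c d + ε

  -- The denominator of ε serves as `k`, because a positive numerator is at least 1.
  reciprocal : ∀ ε → 0ℚ < ε → ∃ (Reciprocal ε)
  reciprocal (mkℚ (+ 0) d c) (*<* (+<+ ()))
  reciprocal (mkℚ -[1+ n ] d c) (*<* ())
  reciprocal ε@(mkℚ (+ suc e) k-1 _) _ = suc k-1 , record
    { k≥1      = s≤s z≤n
    ; ≤-scale  = λ {N} {a} h → scale N a h
    ; ratio-≤  = λ { {a} {suc b} {c} {suc d} _ _ h → bound a b c d h }
    }
    where
    scale : ∀ N a → ε * ℕ→ℚ N ≤ ℕ→ℚ a → N ℕ.≤ suc k-1 ℕ.* a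
    scale N a h = begin
      N                         ≤⟨ ℕ.m≤n*m N (suc e) ⟩
      suc e ℕ.* N               ≡⟨ ℕ.*-identityʳ (suc e ℕ.* N) ⟨
      suc e ℕ.* N ℕ.* 1         ≤⟨ cross-≤-/ unnormalised ⟩
      a ℕ.* suc (k-1 ℕ.* 1)     ≡⟨ cong (λ x → a ℕ.* suc x) (ℕ.*-identityʳ k-1) ⟩
      a ℕ.* suc k-1             ≡⟨ ℕ.*-comm a (suc k-1) ⟩
      suc k-1 ℕ.* a             ∎
      where
      open ℕ.≤-Reasoning
      unnormalised : mkℚᵘ (+ (suc e ℕ.* N)) (k-1 ℕ.* 1) ℚᵘ.≤ mkℚᵘ (+ a) 0
      unnormalised = subst (λ z → mkℚᵘ z (k-1 ℕ.* 1) ℚᵘ.≤ mkℚᵘ (+ a) 0) (sym (pos-* (suc e) N))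
        (ℚᵘ.≤-respʳ-≃ (toℚᵘ-fromℚᵘ (mkℚᵘ (+ a) 0))
          (ℚᵘ.≤-respˡ-≃ (ℚᵘ.≃-trans (toℚᵘ-homo-* ε (ℕ→ℚ N)) (ℚᵘ.*-congˡ {toℚᵘ ε} (toℚᵘ-fromℚᵘ (mkℚᵘ (+ N) 0))))
            (toℚᵘ-mono-≤ h)))
    bound : ∀ a b c d → a ℕ.* suc d ℕ.* suc k-1 ℕ.≤ c ℕ.* suc b ℕ.* suc k-1 ℕ.+ suc b ℕ.* suc d →
      + a / suc b ≤ + c / suc d + ε
    bound a b c d h = toℚᵘ-cancel-≤
      (ℚᵘ.≤-respˡ-≃ (ℚᵘ.≃-sym (toℚᵘ-fromℚᵘ (mkℚᵘ (+ a) b)))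
        (ℚᵘ.≤-respʳ-≃ (ℚᵘ.≃-sym (ℚᵘ.≃-trans (toℚᵘ-homo-+ (+ c / suc d) ε) (ℚᵘ.+-congˡ (toℚᵘ ε) (toℚᵘ-fromℚᵘ (mkℚᵘ (+ c) d)))))
          (subst (mkℚᵘ (+ a) b ℚᵘ.≤_) (sym (+ᵘ-pos c d (suc e) k-1)) (/-cross-≤ cross))))
      where
      open ℕ.≤-Reasoning
      open import Data.Nat.Tactic.RingSolver using (solve-∀)
      arith : ∀ b c d k → c ℕ.* b ℕ.* k ℕ.+ b ℕ.* d ≡ (c ℕ.* k ℕ.+ 1 ℕ.* d) ℕ.* b
      arith = solve-∀
      cross : a ℕ.* (suc d ℕ.* suc k-1) ℕ.≤ (c ℕ.* suc k-1 ℕ.+ suc e ℕ.* suc d) ℕ.* suc b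
      cross = begin
        a ℕ.* (suc d ℕ.* suc k-1)                         ≡⟨ ℕ.*-assoc a (suc d) (suc k-1) ⟨
        a ℕ.* suc d ℕ.* suc k-1                           ≤⟨ h ⟩
        c ℕ.* suc b ℕ.* suc k-1 ℕ.+ suc b ℕ.* suc d       ≡⟨ arith (suc b) c (suc d) (suc k-1) ⟩
        (c ℕ.* suc k-1 ℕ.+ 1 ℕ.* suc d) ℕ.* suc b         ≤⟨ ℕ.*-monoˡ-≤ (suc b) (ℕ.+-monoʳ-≤ (c ℕ.* suc k-1) (ℕ.*-monoˡ-≤ (suc d) (s≤s (z≤n {e})))) ⟩
        (c ℕ.* suc k-1 ℕ.+ suc e ℕ.* suc d) ℕ.* suc b     ∎

  ≤+⇒-≤ : ∀ {x y z} → x ≤ y + z → x - z ≤ y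
  ≤+⇒-≤ {x} {y} {z} h = subst (x - z ≤_) (begin
    y + z - z         ≡⟨ +-assoc y z (- z) ⟩
    y + (z - z)       ≡⟨ cong (λ t → y + t) (+-inverseʳ z) ⟩
    y + 0ℚ            ≡⟨ +-identityʳ y ⟩
    y                 ∎) (+-monoˡ-≤ (- z) h)
    where open ≡-Reasoning

-- Assembly: replacing `1/k` by ε.

open import Data.Bool using (Bool)
open import Data.Nat using (ℕ; suc; _≤_; _<_)
open import Data.Fin using (Fin)
open import Data.Fin.Subset using (Subset; _⊆_; ∣_∣)
open import Data.Rational using (ℚ; 0ℚ; _+_; _-_; _*_) renaming (_≤_ to _≤ℚ_; _<_ to _<ℚ_)
open import Data.Product using (∃-syntax; Σ-syntax; _×_)
open import Relation.Nullary using (¬_)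
open import Relation.Binary.PropositionalEquality using (_≡_; _≢_)
open import Data.Nat.Combinatorics using (_C_)
open import Data.Nat.Properties using (<⇒≱; <⇒≤; ≤-trans)
open import Data.Product using (_,_)
open import Function using (case_of_)
open Combinatorial using (graphs)
open Ratios using (Reciprocal; reciprocal; ≤+⇒-≤)

theorem3p1 : (p q : ℕ) → 1 ≤ p → p < q → (ε : ℚ) → 0ℚ <ℚ ε →
  ∃[ N₀ ] ∀ (N : ℕ) → N₀ ≤ N →
    Σ[ G ∈ (Fin q → Fin N → Fin N → Bool) ] ((∀ (f : Fin q) → IsGraph {N} (G f))
      × (∀ (u v : Fin N) → u ≢ v → #ᵇ (λ f → G f u v) ≡ p)
      × (∀ (f : Fin q) →
          (ratio p q - ε ≤ℚ density (G f) × density (G f) ≤ℚ ratio p q + ε)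
          × ¬ (Σ[ U ∈ Subset N ] (ε * ℕ→ℚ N ≤ℚ ℕ→ℚ ∣ U ∣
                × (∀ (S : Subset N) → S ⊆ U → ∣ S ∣ ≡ q →
                    Σ[ T ∈ Subset N ] (T ⊆ S × ∣ T ∣ ≡ suc p × ε * ℕ→ℚ N ≤ℚ ℕ→ℚ (commonNbrs (G f) T)))))))
theorem3p1 p q 1≤p p<q ε 0<ε = case reciprocal ε 0<ε of λ { (k , ε≥1/k) →
  let open Reciprocal ε≥1/k in
  case graphs p q k 1≤p p<q k≥1 of λ { (N₀ , family≥N₀) →
  N₀ , λ N N₀≤N → case family≥N₀ N N₀≤N of λ { (G , isGraph , exactly-p , 1≤pairs , good) →
  G , isGraph , exactly-p , λ f → case good f of λ { ((lower , upper) , sparse) →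
    ( ≤+⇒-≤ {ratio p q} {density (G f)} (ratio-≤ {p} {q} {edges (G f)} {N C 2} 1≤q 1≤pairs lower)
    , ratio-≤ {edges (G f)} {N C 2} {p} {q} 1≤pairs 1≤q upper )
    , λ { (U , large , every-S) →
        case sparse U (≤-scale {N} {∣ U ∣} large) of λ { (S , S⊆U , ∣S∣ , few) →
        case every-S S S⊆U ∣S∣ of λ { (T , T⊆S , ∣T∣ , many) →
        <⇒≱ (few T T⊆S ∣T∣) (≤-scale {N} {commonNbrs (G f) T} many) } } } } } } }
  where
  1≤q : 1 ≤ q
  1≤q = ≤-trans 1≤p (<⇒≤ p<q)
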